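{- Let $BS(1,3)=\langle a,b \mid ab=ba^3\rangle$ and $BS^{+}(1,3)=\{b^m a^x : m\in\mathbb{Z}_{\geq 0},\ x\in\mathbb{Z}\}$. Let $S$ be a finite non-abelian subset of $BS^{+}(1,3)$ of size $k=|S|\geq 3$, and write $S^2=\{st: s,t\in S\}$. Then: (i) If $S=S_0\cup S_1\cup\cdots\cup S_t$ (the decomposition of $S$ into its nonempty intersections with cosets of $\langle a\rangle$, described in the context) with $t\geq 1$, then $|S^2|\geq \frac{7}{2}|S|-6$. (ii) If $S=b^r a^A=\{b^r a^x : x\in A\}$ for some integer $r\ge 0$, where $A$ is a finite set of integers containing $0$ with $|A|=k$, and $|S^2|=(t+2)k-2t+h<\frac{7}{2}k-6$ for some integer $h$, where $t=c_3(A)$ denotes the number of distinct residue classes modulo $3$ met by $A$, then $A$ is contained in an arithmetic progression of size $k+h<\frac{5}{2}k-t(k-2)-6$.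
   Context: In $BS(1,3)$ one has $a^x b^m=b^m a^{3^m x}$ for $m\ge 0$, so $(b^m a^x)(b^n a^y)=b^{m+n}a^{3^n x+y}$. A set $S$ is called non-abelian if the subgroup it generates is non-abelian. For a finite $S\subseteq BS^{+}(1,3)$, the notation $S=S_0\cup S_1\cup\cdots\cup S_t$ means: $0\le m_0<m_1<\cdots<m_t$ are the distinct integers $m$ such that $S$ meets the coset $b^{m}\langle a\rangle=b^m a^{\mathbb{Z}}$, and $S_i=S\cap b^{m_i}a^{\mathbb{Z}}=b^{m_i}a^{A_i}$ with $A_i\subseteq\mathbb{Z}$ finite nonempty; $k_i=|S_i|$. An arithmetic progression of size $n$ is a set $\{c, c+d,\dots,c+(n-1)d\}$ of integers. -}

module Defs where

open import Data.Nat as ℕ using (ℕ; _^_)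
open import Data.Integer as ℤ using (ℤ; +_; _%ℕ_)
open import Data.Product using (_×_; _,_; ∃-syntax)
open import Data.Product.Properties using (≡-dec)
open import Data.List using (List; map; concatMap; length; deduplicate)
open import Data.List.Membership.Propositional using (_∈_)
open import Relation.Binary.PropositionalEquality using (_≡_; _≢_)
open import Relation.Binary.Definitions using (DecidableEquality)

-- An element b^m a^x of BS⁺(1,3), m ≥ 0, x ∈ ℤ, is encoded as the pair (m , x).
-- Distinct pairs are distinct group elements (normal form b^m a^x).
BS⁺ : Set
BS⁺ = ℕ × ℤ

-- (b^m a^x)(b^n a^y) = b^{m+n} a^{3^n x + y}
_·_ : BS⁺ → BS⁺ → BS⁺
(m , x) · (n , y) = (m ℕ.+ n , (+ (3 ^ n)) ℤ.* x ℤ.+ y)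

_≟BS_ : DecidableEquality BS⁺
_≟BS_ = ≡-dec ℕ._≟_ ℤ._≟_

card : List BS⁺ → ℕ
card xs = length (deduplicate _≟BS_ xs)

sq : List BS⁺ → List BS⁺
sq S = concatMap (λ s → map (s ·_) S) S

-- The subgroup generated by S is non-abelian, i.e. some two elements of S
-- fail to commute (a group generated by pairwise commuting elements is abelian).
NonAbelian : List BS⁺ → Set
NonAbelian S = ∃[ s ] ∃[ u ] (s ∈ S × u ∈ S × s · u ≢ u · s)

c₃ : List ℤ → ℕ
c₃ A = length (deduplicate ℕ._≟_ (map (λ x → x %ℕ 3) A))

InAP : List ℤ → ℕ → Set
InAP A n = ∃[ c ] ∃[ d ] (d ≢ + 0 × (∀ {x} → x ∈ A → ∃[ i ] (i ℕ.< n × x ≡ c ℤ.+ (+ i) ℤ.* d)))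

{-# OPTIONS --safe #-}

-- Every non-abelian finite S ⊆ BS⁺(1,3) satisfies |S²| ≥ (7/2)|S| - 6, also when S lies in a single coset;
-- so (i) holds and the upper bound assumed in (ii) is never met.
-- The top coset T = b^m a^A of S contributes T², of size |A + q A| with q = 3^m.  Splitting A into residue
-- classes mod q, with |X + Y| ≥ |X| + |Y| - 1 in each class, gives |A + q A| ≥ (7/2)|A| - 3: three classes give
-- 4|A| - 3, one class reduces to a smaller set of the same size, and for two classes A₁, A₂ the same splitting
-- is applied to each summand (A_i + q A) / q.
-- Let R = S ∖ T and s ∈ T.  If R is non-abelian, then by induction it is enough to find three elements of
-- sR ∪ Rs outside R²; these come from an element of R of maximal degree in b that does not commute with s.
-- If R is abelian and not inside ⟨a⟩, centralizers being abelian, R meets each coset once and some s ∈ T has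
-- sR ∪ Rs disjoint from R².  If R = a^B, the sets B + B and (q B + A) ∪ (B + A) are compared mod q.
module Submission where

open import Defs
open import Data.Nat as ℕ using (ℕ; zero; suc; _≤_; _<_; z≤n; s≤s; _^_)
import Data.Nat.Properties as ℕₚ
import Data.Nat.Tactic.RingSolver as ℕR
open import Data.Integer as ℤ using (ℤ; +_; ∣_∣)
import Data.Integer.Properties as ℤₚ
import Data.Integer.Tactic.RingSolver as ℤR
open import Data.Integer.Divisibility.Signed using (_∣?_; divides)
open import Algebra.Properties.AbelianGroup ℤₚ.+-0-abelianGroup using (∙-cancelˡ; ∙-cancelʳ)
open import Data.Product using (_×_; _,_; ∃-syntax; proj₁; proj₂)
open import Data.Sum using (_⊎_; inj₁; inj₂; [_,_]′)
open import Data.Unit using (tt)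
open import Data.Empty using (⊥; ⊥-elim)
open import Data.List using (List; []; _∷_; map; length; _++_; filter; deduplicate)
open import Data.List.Properties using (length-++; length-map)
open import Data.List.Membership.Propositional using (_∈_; find; lose)
open import Data.List.Membership.Propositional.Properties
  using (∈-∃++; ∈-++⁻; ∈-++⁺ˡ; ∈-++⁺ʳ; ∈-filter⁺; ∈-filter⁻; ∈-concatMap⁺; ∈-map⁺; ∈-deduplicate⁺)
open import Data.List.Relation.Unary.Any using (here; there; any?)
open import Data.List.Relation.Unary.All as All using (All)
import Data.List.Relation.Unary.All.Properties as All
import Data.List.Relation.Unary.AllPairs as AllPairs
open import Data.List.Relation.Unary.Unique.Propositional using (Unique)
import Data.List.Relation.Unary.Unique.Propositional.Properties as Unique
open import Function using (_∘_; id)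
open import Function.Bundles using (_⇔_)
open import Relation.Nullary using (¬_; Dec; yes; no)
open import Relation.Nullary.Decidable using (map′; ¬?; decidable-stable; _×-dec_)
open import Relation.Binary using (tri<; tri≈; tri>)
open import Relation.Binary.PropositionalEquality
  using (_≡_; _≢_; refl; sym; trans; cong; cong₂; subst; subst₂; module ≡-Reasoning)

-- A linear-arithmetic certificate: h - g exceeds r - l by the slack s, with the terms moved so that no
-- subtraction occurs and the equation is a semiring identity.
≤-by : ∀ {g h l r} s → l ≤ r → g ℕ.+ r ℕ.+ s ≡ h ℕ.+ l → g ≤ h
≤-by {g} {h} {l} {r} s l≤r eq = ℕₚ.+-cancelʳ-≤ r g h
  (ℕₚ.≤-trans (ℕₚ.m≤m+n (g ℕ.+ r) s) (subst (_≤ h ℕ.+ r) (sym eq) (ℕₚ.+-monoʳ-≤ h l≤r)))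

scale : ∀ c {l r} → l ≤ r → c ℕ.* l ≤ c ℕ.* r
scale c = ℕₚ.*-monoʳ-≤ c

-- Counting lower bounds for predicates.

module _ {X : Set} where

  -- P has at least n elements.
  Many : ℕ → (X → Set) → Set
  Many n P = ∃[ xs ] (Unique xs × All P xs × length xs ≡ n)

  list-many : ∀ {xs} → Unique xs → Many (length xs) (_∈ xs)
  list-many {xs} u = xs , u , All.tabulate id , refl

  many-⊆ : ∀ {n} {P Q : X → Set} → (∀ {x} → P x → Q x) → Many n P → Many n Q
  many-⊆ f (xs , u , p , e) = xs , u , All.map f p , e

  many-0 : ∀ {P : X → Set} → Many 0 P
  many-0 = [] , AllPairs.[] , All.[] , refl

  many-1 : ∀ {P : X → Set} x → P x → Many 1 P
  many-1 x p = x ∷ [] , All.[] AllPairs.∷ AllPairs.[] , p All.∷ All.[] , refl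

  many-∪ : ∀ {m n} {P Q R : X → Set} → Many m P → Many n Q → (∀ {x} → P x → Q x → ⊥) →
    (∀ {x} → P x → R x) → (∀ {x} → Q x → R x) → Many (m ℕ.+ n) R
  many-∪ (xs , ux , px , refl) (ys , uy , py , refl) dis f g =
    xs ++ ys , Unique.++⁺ ux uy (λ (x∈ , y∈) → dis (All.lookup px x∈) (All.lookup py y∈)) ,
    All.++⁺ (All.map f px) (All.map g py) , length-++ xs

  many-choose : ∀ {n} {P : X → Set} → Many (suc n) P → ∃[ x ] P x
  many-choose (x ∷ xs , u , p All.∷ ps , e) = x , p

  many-single : ∀ {n} {P : X → Set} → (∀ {x y} → P x → P y → x ≡ y) → Many n P → n ≤ 1
  many-single f ([] , u , p , refl) = z≤n
  many-single f (x ∷ [] , u , p , refl) = s≤s z≤n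
  many-single f (x ∷ y ∷ xs , (x≢y All.∷ _) AllPairs.∷ _ , p All.∷ (p′ All.∷ _) , e) = ⊥-elim (x≢y (f p p′))

  many-split : ∀ {n} {P R : X → Set} → (∀ x → Dec (R x)) → Many n P →
    ∃[ a ] ∃[ b ] (n ≡ a ℕ.+ b × Many a (λ x → P x × R x) × Many b (λ x → P x × ¬ R x))
  many-split {R = R} R? (xs , u , p , refl) = let (a , b , e , m , n) = go xs u in
      a , b , e , many-⊆ (λ (x∈ , r) → All.lookup p x∈ , r) m , many-⊆ (λ (x∈ , r) → All.lookup p x∈ , r) n
    where
    go : ∀ xs → Unique xs → ∃[ a ] ∃[ b ] (length xs ≡ a ℕ.+ b ×
      Many a (λ x → x ∈ xs × R x) × Many b (λ x → x ∈ xs × ¬ R x))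
    go [] u = 0 , 0 , refl , many-0 , many-0
    go (x ∷ xs) (x∉ AllPairs.∷ u) with go xs u | R? x
    ... | a , b , e , m , n | yes r = suc a , b , cong suc e ,
          many-∪ (many-1 {P = λ y → y ≡ x} x refl) m (λ where refl (y∈ , _) → All.lookup x∉ y∈ refl)
            (λ where refl → here refl , r) (λ (y∈ , r) → there y∈ , r) ,
          many-⊆ (λ (y∈ , r) → there y∈ , r) n
    ... | a , b , e , m , n | no ¬r = a , suc b , trans (cong suc e) (sym (ℕₚ.+-suc a b)) ,
          many-⊆ (λ (y∈ , r) → there y∈ , r) m ,
          many-∪ (many-1 {P = λ y → y ≡ x} x refl) n (λ where refl (y∈ , _) → All.lookup x∉ y∈ refl)
            (λ where refl → here refl , ¬r) (λ (y∈ , r) → there y∈ , r)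

  -- Peels off the class of one element `c`, with `c` itself counted in `suc a`. This is how a set
  -- is cut into residue classes.
  many-pivot : ∀ {n} {P : X → Set} {R : X → X → Set} → (∀ x y → Dec (R x y)) → (∀ x → R x x) → Many (suc n) P →
    ∃[ c ] ∃[ a ] ∃[ b ] (n ≡ a ℕ.+ b × Many (suc a) (λ x → P x × R x c) × Many b (λ x → P x × ¬ R x c))
  many-pivot R? rfl (c ∷ xs , (c∉ AllPairs.∷ u) , (pc All.∷ p) , refl) with many-split (λ x → R? x c) (list-many u)
  ... | a , b , e , m₁ , m₂ = c , a , b , e ,
    many-∪ (many-1 {P = λ y → y ≡ c} c refl) m₁ (λ where refl (y∈ , _) → All.lookup c∉ y∈ refl)
      (λ where refl → pc , rfl c) (λ (y∈ , r) → All.lookup p y∈ , r) ,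
    many-⊆ (λ (y∈ , r) → All.lookup p y∈ , r) m₂

  many⇒≤length : ∀ {n} {P : X → Set} ys → (∀ {x} → P x → x ∈ ys) → Many n P → n ≤ length ys
  many⇒≤length ys f (xs , u , p , refl) = go xs ys u (All.map f p)
    where
    skip : ∀ {x y : X} as bs → y ∈ as ++ x ∷ bs → x ≢ y → y ∈ as ++ bs
    skip as bs y∈ x≢y with ∈-++⁻ as y∈
    ... | inj₁ y∈as = ∈-++⁺ˡ y∈as
    ... | inj₂ (here refl) = ⊥-elim (x≢y refl)
    ... | inj₂ (there y∈bs) = ∈-++⁺ʳ as y∈bs
    go : ∀ xs ys → Unique xs → All (_∈ ys) xs → length xs ≤ length ys
    go [] ys u p = z≤n
    go (x ∷ xs) ys (x∉ AllPairs.∷ u) (x∈ All.∷ p) with ∈-∃++ x∈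
    ... | as , bs , refl = subst (suc (length xs) ≤_)
      (sym (trans (length-++ as) (trans (ℕₚ.+-suc _ _) (cong suc (sym (length-++ as))))))
      (s≤s (go xs (as ++ bs) u (All.zipWith (λ (y∈ , x≢y) → skip as bs y∈ x≢y) (p , x∉))))

module _ {X Y : Set} {P : X → Set} {Q : Y → Set} where

  -- Preimages of distinct elements are distinct, so `f` need not be injective; one preimage per
  -- element is enough.
  many-lift : ∀ {n} (f : X → Y) → (∀ {y} → Q y → ∃[ x ] (P x × f x ≡ y)) → Many n Q → Many n P
  many-lift f g (ys , u , q , refl) =
    let (xs , e , p) = go ys q in
    xs , Unique.map⁻ (subst Unique (sym e) u) , p , trans (sym (length-map f xs)) (cong length e)
    where
    go : ∀ ys → All Q ys → ∃[ xs ] (map f xs ≡ ys × All P xs)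
    go [] All.[] = [] , refl , All.[]
    go (y ∷ ys) (q All.∷ qs) =
      let (x , p , e) = g q ; (xs , es , ps) = go ys qs in x ∷ xs , cong₂ _∷_ e es , p All.∷ ps

  many-map : ∀ {n} (f : X → Y) → (∀ {x y} → P x → P y → f x ≡ f y → x ≡ y) →
    (∀ {x} → P x → Q (f x)) → Many n P → Many n Q
  many-map f inj g (xs , u , p , refl) = map f xs , go xs u p , All.map⁺ (All.map g p) , length-map f xs
    where
    go : ∀ xs → Unique xs → All P xs → Unique (map f xs)
    go [] u p = AllPairs.[]
    go (x ∷ xs) (x∉ AllPairs.∷ u) (p All.∷ ps) =
      All.map⁺ (All.zipWith (λ (x≢y , p′) e → x≢y (inj p p′ e)) (x∉ , ps)) AllPairs.∷ go xs u ps

many-max : ∀ {n} {P : ℤ → Set} → Many (suc n) P → ∃[ x ] (P x × Many n (λ y → P y × y ℤ.< x))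
many-max {n} {P} (xs , u , p , e) =
  let (x , x∈ , m) = go n xs u e in x , All.lookup p x∈ , many-⊆ (λ (y∈ , y<) → All.lookup p y∈ , y<) m
  where
  go : ∀ n xs → Unique xs → length xs ≡ suc n → ∃[ x ] (x ∈ xs × Many n (λ y → y ∈ xs × y ℤ.< x))
  go n (x ∷ []) u refl = x , here refl , many-0
  go (suc n) (x ∷ xs@(_ ∷ _)) (x∉ AllPairs.∷ u) refl with go n xs u refl
  ... | y , y∈ , m with ℤₚ.<-cmp x y
  ...   | tri< x<y _ _ = y , there y∈ ,
          many-∪ (many-1 {P = λ z → z ≡ x} x refl) m (λ where refl (x∈ , _) → All.lookup x∉ x∈ refl)
            (λ where refl → here refl , x<y) (λ (z∈ , z<) → there z∈ , z<)
  ...   | tri≈ _ refl _ = ⊥-elim (All.lookup x∉ y∈ refl)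
  ...   | tri> _ _ y<x = x , here refl ,
          many-∪ (many-1 {P = λ z → z ≡ y} y refl) m (λ where refl (_ , y<y) → ℤₚ.<-irrefl refl y<y)
            (λ where refl → there y∈ , y<x) (λ (z∈ , z<) → there z∈ , ℤₚ.<-trans z< y<x)

-- Sumsets of integers

_⊕_ : (ℤ → Set) → (ℤ → Set) → ℤ → Set
(P ⊕ Q) z = ∃[ x ] ∃[ y ] (P x × Q y × z ≡ x ℤ.+ y)

-- Peel off the maximum of `P` again and again: its sum with the maximum of `Q` exceeds every sum
-- that remains.
many-⊕ : ∀ {a b} {P Q : ℤ → Set} → Many (suc a) P → Many (suc b) Q → Many (suc (a ℕ.+ b)) (P ⊕ Q)
many-⊕ {a} {b} {P} {Q} m n with many-max n
... | y , q , n′ = many-⊆ (λ where (u , v , p , (q , _) , e) → u , v , p , q , e) (go a m)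
  where
  -- `Q` may hold beyond the listed elements; cutting it at `y` makes `y` a true maximum.
  Q′ : ℤ → Set
  Q′ z = Q z × z ℤ.≤ y
  n″ : Many (suc b) Q′
  n″ = many-∪ (many-1 {P = λ z → z ≡ y} y refl) n′ (λ where refl (_ , y<y) → ℤₚ.<-irrefl refl y<y)
         (λ where refl → q , ℤₚ.≤-refl) (λ (q , z<) → q , ℤₚ.<⇒≤ z<)
  go : ∀ a {P} → Many (suc a) P → Many (suc (a ℕ.+ b)) (P ⊕ Q′)
  go zero m with many-choose m
  ... | x , p = many-map (λ z → x ℤ.+ z) (λ _ _ → ∙-cancelˡ x _ _) (λ q → x , _ , p , q , refl) n″
  go (suc a) m with many-max m
  ... | x , p , m′ = many-∪ (many-1 {P = λ z → z ≡ x ℤ.+ y} (x ℤ.+ y) refl) (go a m′)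
        (λ where refl (u , v , (_ , u<x) , (_ , v≤y) , e) → ℤₚ.<-irrefl (sym e) (ℤₚ.+-mono-<-≤ u<x v≤y))
        (λ where refl → x , y , p , (q , ℤₚ.≤-refl) , refl)
        (λ where (u , v , (p , _) , q , e) → u , v , p , q , e)

-- Lower bounds n for |X + (A₁ ∪ A₂)| where A₁, A₂ lie in distinct classes mod q, |A₁| = x, |A₂| = y,
-- according to whether X meets one, two or at least three classes.
data TwoClassBound (X x y n : ℕ) : Set where
  one   : 2 ℕ.* X ℕ.+ x ℕ.+ y ≤ n ℕ.+ 2 → TwoClassBound X x y n
  two   : 2 ≤ X → 3 ℕ.* X ℕ.+ 3 ℕ.* (x ℕ.+ y) ≤ 2 ℕ.* n ℕ.+ 6 → TwoClassBound X x y n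
  three : 3 ≤ X → X ℕ.+ 3 ℕ.* x ≤ n ℕ.+ 3 → X ℕ.+ 3 ℕ.* y ≤ n ℕ.+ 3 → TwoClassBound X x y n

-- Linear arithmetic of the class counts.

mixed-bound : ∀ a b n₁ n₂ → let x = suc a ; y = suc b in 2 ℕ.* x ℕ.+ x ℕ.+ y ≤ n₁ ℕ.+ 2 →
  TwoClassBound y x y n₂ → 7 ℕ.* (x ℕ.+ y) ≤ 2 ℕ.* (n₁ ℕ.+ n₂) ℕ.+ 6
mixed-bound a b n₁ n₂ p (one q) =
  ≤-by (a ℕ.+ b) (scale 2 (ℕₚ.+-mono-≤ p q)) (ℕR.solve (a ∷ b ∷ n₁ ∷ n₂ ∷ []))
mixed-bound a b n₁ n₂ p (two u q) =
  ≤-by (2 ℕ.* a) (ℕₚ.+-mono-≤ u (ℕₚ.+-mono-≤ (scale 2 p) q)) (ℕR.solve (a ∷ b ∷ n₁ ∷ n₂ ∷ []))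
-- The two inequalities of `three` carry weights 1/2 and 3/2, so twice the goal is proved.
mixed-bound a b n₁ n₂ p (three u q r) = ℕₚ.*-cancelˡ-≤ 2
  (≤-by (a ℕ.+ 2)
    (ℕₚ.+-mono-≤ (scale 3 u) (ℕₚ.+-mono-≤ (scale 4 p) (ℕₚ.+-mono-≤ q (scale 3 r))))
    (ℕR.solve (a ∷ b ∷ n₁ ∷ n₂ ∷ [])))

-- Adding the two inequalities of `three`, or spending `2 ≤ X` in `two`, leaves bounds symmetric in
-- `x` and `y`, ready to be summed over both summands.
many-class-bound : ∀ {X x y n} → TwoClassBound X x y n → 2 ℕ.* X ℕ.+ x ℕ.+ y ≤ n ℕ.+ 2 ⊎
  (2 ≤ X × 2 ℕ.* X ℕ.+ 2 ℕ.+ 3 ℕ.* (x ℕ.+ y) ≤ 2 ℕ.* n ℕ.+ 6) ⊎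
  (3 ≤ X × 2 ℕ.* X ℕ.+ 3 ℕ.* (x ℕ.+ y) ≤ 2 ℕ.* n ℕ.+ 6)
many-class-bound (one p) = inj₁ p
many-class-bound {X} {x} {y} {n} (two u p) =
  inj₂ (inj₁ (u , ≤-by 0 (ℕₚ.+-mono-≤ u p) (ℕR.solve (X ∷ x ∷ y ∷ n ∷ []))))
many-class-bound {X} {x} {y} {n} (three u p q) =
  inj₂ (inj₂ (u , ≤-by 0 (ℕₚ.+-mono-≤ p q) (ℕR.solve (X ∷ x ∷ y ∷ n ∷ []))))

swap-bound : ∀ {X x y n} → TwoClassBound X x y n → TwoClassBound X y x n
swap-bound {X} {x} {y} {n} (one p) = one (≤-by 0 p (ℕR.solve (X ∷ x ∷ y ∷ n ∷ [])))
swap-bound {X} {x} {y} {n} (two p q) = two p (≤-by 0 q (ℕR.solve (X ∷ x ∷ y ∷ n ∷ [])))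
swap-bound (three p q r) = three p r q

-- The two summands have `X` of size `x` and of size `y`. If either `X` lies in one class,
-- `mixed-bound` applies; otherwise the symmetric bounds add up to 8(x + y) on the left, and the
-- lower bounds on `x` and `y` absorb the constant.
combine-bounds : ∀ a b n₁ n₂ → let x = suc a ; y = suc b in
  TwoClassBound x x y n₁ → TwoClassBound y x y n₂ → 7 ℕ.* (x ℕ.+ y) ≤ 2 ℕ.* (n₁ ℕ.+ n₂) ℕ.+ 6
combine-bounds a b n₁ n₂ p q with many-class-bound p | many-class-bound q
... | inj₁ p′ | _ = mixed-bound a b n₁ n₂ p′ q
... | inj₂ _ | inj₁ q′ =
  ≤-by 0 (mixed-bound b a n₂ n₁ (≤-by 0 q′ (ℕR.solve (a ∷ b ∷ n₂ ∷ []))) (swap-bound p))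
    (ℕR.solve (a ∷ b ∷ n₁ ∷ n₂ ∷ []))
... | inj₂ (inj₁ (u , p′)) | inj₂ (inj₁ (v , q′)) =
  ≤-by 2 (ℕₚ.+-mono-≤ (ℕₚ.+-mono-≤ u v) (ℕₚ.+-mono-≤ p′ q′)) (ℕR.solve (a ∷ b ∷ n₁ ∷ n₂ ∷ []))
... | inj₂ (inj₁ (u , p′)) | inj₂ (inj₂ (v , q′)) =
  ≤-by 1 (ℕₚ.+-mono-≤ (ℕₚ.+-mono-≤ u v) (ℕₚ.+-mono-≤ p′ q′)) (ℕR.solve (a ∷ b ∷ n₁ ∷ n₂ ∷ []))
... | inj₂ (inj₂ (u , p′)) | inj₂ (inj₁ (v , q′)) =
  ≤-by 1 (ℕₚ.+-mono-≤ (ℕₚ.+-mono-≤ u v) (ℕₚ.+-mono-≤ p′ q′)) (ℕR.solve (a ∷ b ∷ n₁ ∷ n₂ ∷ []))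
... | inj₂ (inj₂ (u , p′)) | inj₂ (inj₂ (v , q′)) =
  ≤-by 0 (ℕₚ.+-mono-≤ (ℕₚ.+-mono-≤ u v) (ℕₚ.+-mono-≤ p′ q′)) (ℕR.solve (a ∷ b ∷ n₁ ∷ n₂ ∷ []))

three-class-dilate : ∀ a b e → let k = a ℕ.+ (suc b ℕ.+ suc e) in
  7 ℕ.* suc k ≤ 2 ℕ.* (suc (a ℕ.+ k) ℕ.+ (suc (b ℕ.+ k) ℕ.+ suc (e ℕ.+ k))) ℕ.+ 6
three-class-dilate a b e = ≤-by (a ℕ.+ b ℕ.+ e ℕ.+ 3) (ℕₚ.≤-refl {0}) (ℕR.solve (a ∷ b ∷ e ∷ []))

-- The three final cases of `many-cross`: `B` meets two classes; `B` lies in one class and at most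
-- half of `A` is divisible by q; the same with at least half of `A` divisible.
cross-count₁ : ∀ k u v → 7 ℕ.* suc k ≤ 2 ℕ.* (suc (k ℕ.+ k) ℕ.+ (suc (k ℕ.+ u) ℕ.+ suc (k ℕ.+ v))) ℕ.+ 4
cross-count₁ k u v = ≤-by (k ℕ.+ 2 ℕ.* u ℕ.+ 2 ℕ.* v ℕ.+ 3) (ℕₚ.≤-refl {0}) (ℕR.solve (k ∷ u ∷ v ∷ []))

cross-count₂ : ∀ p r u → p ≤ suc r → 7 ℕ.* suc (p ℕ.+ r) ≤
  2 ℕ.* (suc (p ℕ.+ r ℕ.+ (p ℕ.+ r)) ℕ.+ (suc (p ℕ.+ r ℕ.+ u) ℕ.+ suc (r ℕ.+ u))) ℕ.+ 4
cross-count₂ p r u p≤r = ≤-by (4 ℕ.* u ℕ.+ 2) p≤r (ℕR.solve (p ∷ r ∷ u ∷ []))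

cross-count₃ : ∀ p r u → suc r ≤ suc p → 7 ℕ.* suc (suc p ℕ.+ r) ≤
  2 ℕ.* (suc (p ℕ.+ p) ℕ.+ suc (p ℕ.+ r) ℕ.+ (suc (suc p ℕ.+ r ℕ.+ u) ℕ.+ suc (r ℕ.+ u))) ℕ.+ 4
cross-count₃ p r u r≤p = ≤-by (4 ℕ.* u) r≤p (ℕR.solve (p ∷ r ∷ u ∷ []))

one-class-bound : ∀ k a b → TwoClassBound (suc k) (suc a) (suc b) (suc (k ℕ.+ a) ℕ.+ suc (k ℕ.+ b))
one-class-bound k a b = one (ℕₚ.≤-reflexive (ℕR.solve (k ∷ a ∷ b ∷ [])))

three-class-bound : ∀ u v w a b m → a ≤ m → b ≤ m → TwoClassBound (suc u ℕ.+ (suc v ℕ.+ suc w)) (suc a) (suc b)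
  (suc (u ℕ.+ m) ℕ.+ (suc (v ℕ.+ m) ℕ.+ suc (w ℕ.+ m)))
three-class-bound u v w a b m a≤m b≤m = three
  (≤-by (u ℕ.+ v ℕ.+ w) (ℕₚ.≤-refl {0}) (ℕR.solve (u ∷ v ∷ w ∷ [])))
  (≤-by 0 (scale 3 a≤m) (ℕR.solve (u ∷ v ∷ w ∷ a ∷ m ∷ [])))
  (≤-by 0 (scale 3 b≤m) (ℕR.solve (u ∷ v ∷ w ∷ b ∷ m ∷ [])))

two-class-bound : ∀ u v a b n → u ℕ.+ v ℕ.+ a ℕ.+ b ≤ 2 ℕ.* n →
  TwoClassBound (suc u ℕ.+ suc v) (suc a) (suc b) (u ℕ.+ v ℕ.+ a ℕ.+ b ℕ.+ 3 ℕ.+ n)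
two-class-bound u v a b n p = two
  (≤-by (u ℕ.+ v) (ℕₚ.≤-refl {0}) (ℕR.solve (u ∷ v ∷ [])))
  (≤-by 0 p (ℕR.solve (u ∷ v ∷ a ∷ b ∷ n ∷ [])))

two-class-count₁ : ∀ u v a b → suc (u ℕ.+ a) ℕ.+ (suc (u ℕ.+ b) ℕ.+ suc (v ℕ.+ b)) ≡
  u ℕ.+ v ℕ.+ a ℕ.+ b ℕ.+ 3 ℕ.+ (u ℕ.+ b)
two-class-count₁ = ℕR.solve-∀
two-class-count₂ : ∀ u v a b → suc (u ℕ.+ a) ℕ.+ (suc (v ℕ.+ a) ℕ.+ suc (v ℕ.+ b)) ≡
  u ℕ.+ v ℕ.+ a ℕ.+ b ℕ.+ 3 ℕ.+ (v ℕ.+ a)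
two-class-count₂ = ℕR.solve-∀

-- Residue classes modulo an odd q

module Mod (q : ℕ) (q≥2 : 2 ≤ q) (h : ℤ) (odd : + q ≡ + 1 ℤ.+ (h ℤ.+ h)) where

  Q : ℤ
  Q = + q

  instance
    Q-nonZero : ℤ.NonZero Q
    Q-nonZero = ℕ.>-nonZero (ℕₚ.≤-trans (s≤s z≤n) q≥2)

  infix 4 _≈_ _≉_
  -- Kept as an equation for `x`, so that matching it with `refl` substitutes `y` plus a multiple of
  -- `Q`.
  record _≈_ (x y : ℤ) : Set where
    constructor quot
    field
      quotient : ℤ
      equality   : x ≡ y ℤ.+ Q ℤ.* quotient

  _≉_ : ℤ → ℤ → Set
  x ≉ y = ¬ x ≈ y

  _≈?_ : ∀ x y → Dec (x ≈ y)
  x ≈? y = map′ (λ (divides w e) → quot w (begin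
      x                        ≡⟨ split x y ⟩
      y ℤ.+ (x ℤ.- y)          ≡⟨ cong (λ z → y ℤ.+ z) e ⟩
      y ℤ.+ w ℤ.* Q            ≡⟨ cong (λ z → y ℤ.+ z) (ℤₚ.*-comm w Q) ⟩
      y ℤ.+ Q ℤ.* w            ∎))
    (λ (quot w e) → divides w (trans (cong (λ z → z ℤ.- y) e) (diff y Q w)))
    (Q ∣? (x ℤ.- y))
    where
    open ≡-Reasoning
    split : ∀ x y → x ≡ y ℤ.+ (x ℤ.- y)
    split = ℤR.solve-∀
    diff : ∀ y Q w → y ℤ.+ Q ℤ.* w ℤ.- y ≡ w ℤ.* Q
    diff = ℤR.solve-∀

  ≈-refl : ∀ {x} → x ≈ x
  ≈-refl {x} = quot (+ 0) (eq x Q)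
    where
    eq : ∀ x Q → x ≡ x ℤ.+ Q ℤ.* + 0
    eq = ℤR.solve-∀

  ≈-sym : ∀ {x y} → x ≈ y → y ≈ x
  ≈-sym {_} {y} (quot w refl) = quot (ℤ.- w) (eq y Q w)
    where
    eq : ∀ y Q w → y ≡ y ℤ.+ Q ℤ.* w ℤ.+ Q ℤ.* (ℤ.- w)
    eq = ℤR.solve-∀

  ≈-trans : ∀ {x y z} → x ≈ y → y ≈ z → x ≈ z
  ≈-trans {z = z} (quot w refl) (quot v refl) = quot (v ℤ.+ w) (eq z Q v w)
    where
    eq : ∀ z Q v w → z ℤ.+ Q ℤ.* v ℤ.+ Q ℤ.* w ≡ z ℤ.+ Q ℤ.* (v ℤ.+ w)
    eq = ℤR.solve-∀

  ≈-+ : ∀ {x y u v} → x ≈ y → u ≈ v → x ℤ.+ u ≈ y ℤ.+ v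
  ≈-+ {_} {y} {_} {v} (quot w refl) (quot w′ refl) = quot (w ℤ.+ w′) (eq y v Q w w′)
    where
    eq : ∀ y v Q w w′ → y ℤ.+ Q ℤ.* w ℤ.+ (v ℤ.+ Q ℤ.* w′) ≡ y ℤ.+ v ℤ.+ Q ℤ.* (w ℤ.+ w′)
    eq = ℤR.solve-∀

  ≈-cancelʳ : ∀ {x y u v} → u ≈ v → x ℤ.+ u ≈ y ℤ.+ v → x ≈ y
  ≈-cancelʳ {x} {y} {u} {v} (quot w refl) (quot w′ e) = quot (w′ ℤ.- w) (begin
      x                                             ≡⟨ eq₁ x u ⟩
      x ℤ.+ u ℤ.- u                                  ≡⟨ cong (λ z → z ℤ.- u) e ⟩
      y ℤ.+ v ℤ.+ Q ℤ.* w′ ℤ.- (v ℤ.+ Q ℤ.* w)         ≡⟨ eq₂ y v Q w w′ ⟩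
      y ℤ.+ Q ℤ.* (w′ ℤ.- w)                         ∎)
    where
    open ≡-Reasoning
    eq₁ : ∀ x u → x ≡ x ℤ.+ u ℤ.- u
    eq₁ = ℤR.solve-∀
    eq₂ : ∀ y v Q w w′ → y ℤ.+ v ℤ.+ Q ℤ.* w′ ℤ.- (v ℤ.+ Q ℤ.* w) ≡ y ℤ.+ Q ℤ.* (w′ ℤ.- w)
    eq₂ = ℤR.solve-∀

  ≈-cancelˡ : ∀ {x y u v} → x ≈ y → x ℤ.+ u ≈ y ℤ.+ v → u ≈ v
  ≈-cancelˡ {x} {y} {u} {v} x≈y e rewrite ℤₚ.+-comm x u | ℤₚ.+-comm y v = ≈-cancelʳ x≈y e

  -- q = 1 + 2h gives d = q d - h (2d) for d = x - y.
  ≈-halve : ∀ {x y} → x ℤ.+ x ≈ y ℤ.+ y → x ≈ y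
  ≈-halve {x} {y} (quot w e) = quot (x ℤ.- y ℤ.- h ℤ.* w) (begin
      x                                                        ≡⟨ eq₁ x y h ⟩
      y ℤ.+ ((+ 1 ℤ.+ (h ℤ.+ h)) ℤ.* (x ℤ.- y) ℤ.- h ℤ.* (x ℤ.+ x ℤ.- (y ℤ.+ y)))
        ≡⟨ cong₂ (λ q z → y ℤ.+ (q ℤ.* (x ℤ.- y) ℤ.- h ℤ.* (z ℤ.- (y ℤ.+ y)))) (sym odd) e ⟩
      y ℤ.+ (Q ℤ.* (x ℤ.- y) ℤ.- h ℤ.* (y ℤ.+ y ℤ.+ Q ℤ.* w ℤ.- (y ℤ.+ y)))
        ≡⟨ eq₂ x y h Q w ⟩
      y ℤ.+ Q ℤ.* (x ℤ.- y ℤ.- h ℤ.* w)                           ∎)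
    where
    open ≡-Reasoning
    eq₁ : ∀ x y h → x ≡ y ℤ.+ ((+ 1 ℤ.+ (h ℤ.+ h)) ℤ.* (x ℤ.- y) ℤ.- h ℤ.* (x ℤ.+ x ℤ.- (y ℤ.+ y)))
    eq₁ = ℤR.solve-∀
    eq₂ : ∀ x y h Q w → y ℤ.+ (Q ℤ.* (x ℤ.- y) ℤ.- h ℤ.* (y ℤ.+ y ℤ.+ Q ℤ.* w ℤ.- (y ℤ.+ y))) ≡
      y ℤ.+ Q ℤ.* (x ℤ.- y ℤ.- h ℤ.* w)
    eq₂ = ℤR.solve-∀

  Q*-≈ : ∀ x y → Q ℤ.* x ≈ Q ℤ.* y
  Q*-≈ x y = quot (x ℤ.- y) (eq Q x y)
    where
    eq : ∀ Q x y → Q ℤ.* x ≡ Q ℤ.* y ℤ.+ Q ℤ.* (x ℤ.- y)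
    eq = ℤR.solve-∀

  -- Splitting sumsets along residue classes.

  _∩_ : (ℤ → Set) → ℤ → ℤ → Set
  (P ∩ c) x = P x × x ≈ c

  Apart : (ℤ → Set) → (ℤ → Set) → Set
  Apart P R = ∀ {x y} → P x → R y → x ≉ y

  Congruent : (ℤ → Set) → (ℤ → Set) → Set
  Congruent P R = ∀ {x y} → P x → R y → x ≈ y

  ∩-congruent : ∀ {P R c} → Congruent (P ∩ c) (R ∩ c)
  ∩-congruent (_ , x≈c) (_ , y≈c) = ≈-trans x≈c (≈-sym y≈c)

  ∩-apart : ∀ {P R c d} → c ≉ d → Apart (P ∩ c) (R ∩ d)
  ∩-apart c≉d (_ , x≈c) (_ , y≈d) x≈y = c≉d (≈-trans (≈-sym x≈c) (≈-trans x≈y y≈d))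

  apartˡ : ∀ {P P′ R R′} → Apart P P′ → Congruent R R′ → Apart (P ⊕ R) (P′ ⊕ R′)
  apartˡ ap con (_ , _ , p , r , refl) (_ , _ , p′ , r′ , refl) e = ap p p′ (≈-cancelʳ (con r r′) e)

  apartʳ : ∀ {P P′ R R′} → Congruent P P′ → Apart R R′ → Apart (P ⊕ R) (P′ ⊕ R′)
  apartʳ con ap (_ , _ , p , r , refl) (_ , _ , p′ , r′ , refl) e = ap r r′ (≈-cancelˡ (con p p′) e)

  apart-⊕ : ∀ {P P′ R R′ c c′ d d′} → c ℤ.+ d ≉ c′ ℤ.+ d′ → Apart ((P ∩ c) ⊕ (R ∩ d)) ((P′ ∩ c′) ⊕ (R′ ∩ d′))
  apart-⊕ ne (_ , _ , (_ , p) , (_ , r) , refl) (_ , _ , (_ , p′) , (_ , r′) , refl) e =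
    ne (≈-trans (≈-sym (≈-+ p r)) (≈-trans e (≈-+ p′ r′)))

  many-apart : ∀ {m n P R S} → Many m P → Many n R → Apart P R → (∀ {x} → P x → S x) → (∀ {x} → R x → S x) →
    Many (m ℕ.+ n) S
  many-apart m n ap = many-∪ m n (λ p r → ap p r ≈-refl)

  many-apart₃ : ∀ {m n k P R T S} → Many m P → Many n R → Many k T → Apart P R → Apart P T → Apart R T →
    (∀ {x} → P x → S x) → (∀ {x} → R x → S x) → (∀ {x} → T x → S x) → Many (m ℕ.+ (n ℕ.+ k)) S
  many-apart₃ m n k pr pt rt f g g′ = many-apart m (many-apart n k rt inj₁ inj₂)
    (λ p → [ pr p , pt p ]′) f [ g , g′ ]′

  -- The last part in `three` may spread over several classes; all that matters is that it avoids
  -- the first two.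
  data Classes (P : ℤ → Set) (k : ℕ) : Set where
    one   : ∀ c → Many k (P ∩ c) → Classes P k
    two   : ∀ {a b} c d → c ≉ d → k ≡ suc a ℕ.+ suc b → Many (suc a) (P ∩ c) → Many (suc b) (P ∩ d) → Classes P k
    three : ∀ {a b e} c d → c ≉ d → k ≡ suc a ℕ.+ (suc b ℕ.+ suc e) → Many (suc a) (P ∩ c) → Many (suc b) (P ∩ d) →
            Many (suc e) (λ x → P x × x ≉ c × x ≉ d) → Classes P k

  classes : ∀ {P k} → Many (suc k) P → Classes P (suc k)
  classes m with many-pivot _≈?_ (λ _ → ≈-refl) m
  ... | c , a , zero , e , m₁ , _ = one c (subst (λ k → Many (suc k) _) (sym (trans e (ℕₚ.+-identityʳ _))) m₁)
  ... | c , a , suc b , refl , m₁ , m₂ with many-pivot _≈?_ (λ _ → ≈-refl) m₂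
  ... | d , b′ , e′ , e , m₃ , m₄ = go e′ e m₄
    where
    c≉d : c ≉ d
    c≉d c≈d = let (_ , (_ , x≉c) , x≈d) = many-choose m₃ in x≉c (≈-trans x≈d (≈-sym c≈d))
    m₅ = many-⊆ (λ ((p , _) , x≈d) → p , x≈d) m₃
    go : ∀ e′ → b ≡ b′ ℕ.+ e′ → Many e′ _ → Classes _ _
    go zero refl _ = two c d c≉d (cong (λ b → suc a ℕ.+ suc b) (ℕₚ.+-identityʳ _)) m₁ m₅
    go (suc e′) refl m₄ = three c d c≉d refl m₁ m₅ (many-⊆ (λ ((p , x≉c) , x≉d) → p , x≉c , x≉d) m₄)

  ⊕-⊆ : ∀ {P P′ R R′} → (∀ {x} → P x → P′ x) → (∀ {x} → R x → R′ x) → ∀ {z} → (P ⊕ R) z → (P′ ⊕ R′) z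
  ⊕-⊆ f g (x , y , p , r , e) = x , y , f p , g r , e

  -- Adding a set that lies in one class keeps the three parts of `X` apart, so their sumset bounds
  -- add up.
  many-three-⊕ : ∀ {X a b e k c d R} → c ≉ d →
    Many (suc a) (X ∩ c) → Many (suc b) (X ∩ d) → Many (suc e) (λ x → X x × x ≉ c × x ≉ d) →
    Congruent R R → Many (suc k) R →
    Many (suc (a ℕ.+ k) ℕ.+ (suc (b ℕ.+ k) ℕ.+ suc (e ℕ.+ k))) (X ⊕ R)
  many-three-⊕ {X = X} c≉d m₁ m₂ m₃ con r =
    many-apart₃ (many-⊕ m₁ r) (many-⊕ m₂ r) (many-⊕ m₃ r)
      (apartˡ (∩-apart {X} {X} c≉d) con)
      (apartˡ (λ (_ , x≈c) (_ , y≉c , _) x≈y → y≉c (≈-trans (≈-sym x≈y) x≈c)) con)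
      (apartˡ (λ (_ , x≈d) (_ , _ , y≉d) x≈y → y≉d (≈-trans (≈-sym x≈y) x≈d)) con)
      (⊕-⊆ proj₁ id) (⊕-⊆ proj₁ id) (⊕-⊆ proj₁ id)

  -- The classes f + c and g + d differ by hypothesis, and each mixed class f + d, g + c differs
  -- from both. The mixed classes may coincide, so only the larger one is counted; its share `n` is
  -- at least the average.
  many-two-⊕ : ∀ {X P u v a b f g c d} → f ≉ g → c ≉ d → f ℤ.+ c ≉ g ℤ.+ d →
    Many (suc u) (X ∩ f) → Many (suc v) (X ∩ g) → Many (suc a) (P ∩ c) → Many (suc b) (P ∩ d) →
    ∃[ n ] (u ℕ.+ v ℕ.+ a ℕ.+ b ≤ 2 ℕ.* n × Many (u ℕ.+ v ℕ.+ a ℕ.+ b ℕ.+ 3 ℕ.+ n) (X ⊕ P))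
  many-two-⊕ {X} {P} {u} {v} {a} {b} {f} {g} {c} {d} f≉g c≉d ne x₁ x₂ m₁ m₂ with ℕₚ.≤-total (v ℕ.+ a) (u ℕ.+ b)
  ... | inj₁ le = u ℕ.+ b , ≤-by 0 le (ℕR.solve (u ∷ v ∷ a ∷ b ∷ [])) ,
    subst (λ n → Many n (X ⊕ P)) (two-class-count₁ u v a b) (many-apart₃ (many-⊕ x₁ m₁) (many-⊕ x₁ m₂) (many-⊕ x₂ m₂)
      (apartʳ (∩-congruent {X} {X} {f}) (∩-apart {P} {P} c≉d)) (apart-⊕ {X} {X} {P} {P} ne)
      (apartˡ (∩-apart {X} {X} f≉g) (∩-congruent {P} {P} {d}))
      (⊕-⊆ proj₁ proj₁) (⊕-⊆ proj₁ proj₁) (⊕-⊆ proj₁ proj₁))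
  ... | inj₂ le = v ℕ.+ a , ≤-by 0 le (ℕR.solve (u ∷ v ∷ a ∷ b ∷ [])) ,
    subst (λ n → Many n (X ⊕ P)) (two-class-count₂ u v a b) (many-apart₃ (many-⊕ x₁ m₁) (many-⊕ x₂ m₁) (many-⊕ x₂ m₂)
      (apartˡ (∩-apart {X} {X} f≉g) (∩-congruent {P} {P} {c})) (apart-⊕ {X} {X} {P} {P} ne)
      (apartʳ (∩-congruent {X} {X} {g}) (∩-apart {P} {P} c≉d))
      (⊕-⊆ proj₁ proj₁) (⊕-⊆ proj₁ proj₁) (⊕-⊆ proj₁ proj₁))

  two-class-⊕ : ∀ {k a b c d P X} → c ≉ d → Many (suc a) (P ∩ c) → Many (suc b) (P ∩ d) → Many (suc k) X →
    ∃[ n ] (TwoClassBound (suc k) (suc a) (suc b) n × Many n (X ⊕ P))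
  two-class-⊕ {k} {a} {b} {c} {d} {P} {X} c≉d m₁ m₂ m with classes m
  ... | one f m′ = _ , one-class-bound k a b ,
      many-apart (many-⊕ m′ m₁) (many-⊕ m′ m₂) (apartʳ (∩-congruent {X} {X} {f}) (∩-apart {P} {P} c≉d))
        (⊕-⊆ proj₁ proj₁) (⊕-⊆ proj₁ proj₁)
  ... | three {u} {v} {w} f g f≉g refl x₁ x₂ x₃ with ℕₚ.≤-total a b
  ...   | inj₁ a≤b = _ , three-class-bound u v w a b b a≤b ℕₚ.≤-refl ,
          many-⊆ (⊕-⊆ id proj₁) (many-three-⊕ f≉g x₁ x₂ x₃ (∩-congruent {P} {P} {d}) m₂)
  ...   | inj₂ b≤a = _ , three-class-bound u v w a b a ℕₚ.≤-refl b≤a ,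
          many-⊆ (⊕-⊆ id proj₁) (many-three-⊕ f≉g x₁ x₂ x₃ (∩-congruent {P} {P} {c}) m₁)
  two-class-⊕ {k} {a} {b} {c} {d} {P} {X} c≉d m₁ m₂ m
      | two {u} {v} f g f≉g refl x₁ x₂ with (f ℤ.+ c) ≈? (g ℤ.+ d)
  ...   | no ne = let (n , bound , s) = many-two-⊕ f≉g c≉d ne x₁ x₂ m₁ m₂ in
          _ , two-class-bound u v a b n bound , s
  -- Exchange `f` and `g`. If g + c and f + d were congruent too, adding the congruences would give
  -- 2c ≈ 2d, hence c ≈ d because q is odd.
  ...   | yes e = let (n , bound , s) = many-two-⊕ (f≉g ∘ ≈-sym) c≉d ne x₂ x₁ m₁ m₂ in
          _ , subst (λ X → TwoClassBound X (suc a) (suc b) (v ℕ.+ u ℕ.+ a ℕ.+ b ℕ.+ 3 ℕ.+ n)) (ℕₚ.+-comm (suc v) (suc u))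
                (two-class-bound v u a b n bound) , s
    where
    eq₁ : ∀ f g c → f ℤ.+ c ℤ.+ (g ℤ.+ c) ≡ f ℤ.+ g ℤ.+ (c ℤ.+ c)
    eq₁ = ℤR.solve-∀
    eq₂ : ∀ f g d → g ℤ.+ d ℤ.+ (f ℤ.+ d) ≡ f ℤ.+ g ℤ.+ (d ℤ.+ d)
    eq₂ = ℤR.solve-∀
    ne : g ℤ.+ c ≉ f ℤ.+ d
    ne e′ = c≉d (≈-halve (≈-cancelˡ (≈-refl {f ℤ.+ g}) (subst₂ _≈_ (eq₁ f g c) (eq₂ f g d) (≈-+ e e′))))

  -- Sums of dilates and descent through a residue class.

  Scaled : (ℤ → Set) → ℤ → Set
  Scaled P z = ∃[ x ] (P x × z ≡ Q ℤ.* x)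

  many-scaled : ∀ {n P} → Many n P → Many n (Scaled P)
  many-scaled = many-map (λ x → Q ℤ.* x) (λ _ _ → ℤₚ.*-cancelˡ-≡ Q _ _) (λ p → _ , p , refl)

  scaled-congruent : ∀ {P R} → Congruent (Scaled P) (Scaled R)
  scaled-congruent (x , _ , refl) (y , _ , refl) = Q*-≈ x y

  -- The class of `c` in `P` after subtracting `c` and dividing by `Q`: same size, distances `Q`
  -- times smaller.
  Descend : ℤ → (ℤ → Set) → ℤ → Set
  Descend c P z = P (c ℤ.+ Q ℤ.* z)

  affine-injective : ∀ c {x y} → c ℤ.+ Q ℤ.* x ≡ c ℤ.+ Q ℤ.* y → x ≡ y
  affine-injective c e = ℤₚ.*-cancelˡ-≡ Q _ _ (∙-cancelˡ c _ _ e)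

  many-descend : ∀ {n c P} → Many n (P ∩ c) → Many n (Descend c P)
  many-descend {c = c} = many-lift (λ z → c ℤ.+ Q ℤ.* z) (λ where (p , quot w refl) → w , p , refl)

  -- As q is at least 2, division by `Q` lowers a positive bound by at least 1, which makes the
  -- bound an induction measure.
  descend-< : ∀ {N} z → ∣ Q ℤ.* z ∣ ≤ suc N → ∣ z ∣ ≤ N
  descend-< {N} z p = ℕₚ.≮⇒≥ λ N<z → ℕₚ.<⇒≱ (ℕₚ.≤-trans
    (≤-by N (ℕₚ.*-mono-≤ q≥2 N<z) (eq N (q ℕ.* ∣ z ∣))) (ℕₚ.≤-reflexive (sym (ℤₚ.abs-* Q z)))) p
    where
    eq : ∀ N k → 2 ℕ.+ N ℕ.+ k ℕ.+ N ≡ k ℕ.+ 2 ℕ.* suc N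
    eq = ℕR.solve-∀

  Dilate : (ℤ → Set) → ℤ → Set
  Dilate P = P ⊕ Scaled P

  -- Induction on a bound `N` for the diameter. A set in one class is an affine image of its
  -- descent, and so is its dilate sum.
  many-dilate : ∀ N k {P} → (∀ {x y} → P x → P y → ∣ x ℤ.- y ∣ ≤ N) → Many (suc k) P →
    ∃[ n ] (7 ℕ.* suc k ≤ 2 ℕ.* n ℕ.+ 6 × Many n (Dilate P))
  many-dilate zero k {P} bd m = 1 , ≤-by 1 (scale 7 (many-single single m)) (ℕR.solve (k ∷ [])) ,
    many-1 _ (x , Q ℤ.* x , p , (x , p , refl) , refl)
    where
    single : ∀ {x y} → P x → P y → x ≡ y
    single p r = ℤₚ.i-j≡0⇒i≡j _ _ (ℤₚ.∣i∣≡0⇒i≡0 (ℕₚ.n≤0⇒n≡0 (bd p r)))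
    x = proj₁ (many-choose m)
    p = proj₂ (many-choose m)
  many-dilate (suc N) k {P} bd m with classes m
  ... | one c m₁ =
    let (n , le , s) = many-dilate N k
                         (λ {x} {y} p r → descend-< (x ℤ.- y) (subst (λ z → ∣ z ∣ ≤ suc N) (diff c Q x y) (bd p r)))
                         (many-descend m₁) in
    n , le , many-map (λ z → (c ℤ.+ Q ℤ.* c) ℤ.+ Q ℤ.* z) (λ _ _ → affine-injective (c ℤ.+ Q ℤ.* c))
      (λ where (x , _ , p , (y , r , refl) , refl) → _ , _ , p , (_ , r , refl) , eq c Q x y) s
    where
    diff : ∀ c Q x y → c ℤ.+ Q ℤ.* x ℤ.- (c ℤ.+ Q ℤ.* y) ≡ Q ℤ.* (x ℤ.- y)
    diff = ℤR.solve-∀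
    eq : ∀ c Q x y → (c ℤ.+ Q ℤ.* c) ℤ.+ Q ℤ.* (x ℤ.+ Q ℤ.* y) ≡ (c ℤ.+ Q ℤ.* x) ℤ.+ Q ℤ.* (c ℤ.+ Q ℤ.* y)
    eq = ℤR.solve-∀
  ... | three {a} {b} {e} c d c≉d refl m₁ m₂ m₃ = _ , three-class-dilate a b e ,
    many-three-⊕ c≉d m₁ m₂ m₃ (scaled-congruent {P} {P}) (many-scaled m)
  ... | two {a} {b} c d c≉d refl m₁ m₂ =
    -- The class of `c` plus q P equals c + q (X + P), where X is the descent at `c`; so the summand
    -- X meets the two classes of `P` again.
    let (n₁ , bd₁ , s₁) = two-class-⊕ c≉d m₁ m₂ (many-descend m₁)
        (n₂ , bd₂ , s₂) = two-class-⊕ c≉d m₁ m₂ (many-descend m₂) in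
    n₁ ℕ.+ n₂ , combine-bounds a b n₁ n₂ bd₁ bd₂ ,
    many-apart (lift c s₁) (lift d s₂) (apartˡ (∩-apart {P} {P} c≉d) (scaled-congruent {P} {P}))
      (⊕-⊆ proj₁ id) (⊕-⊆ proj₁ id)
    where
    eq : ∀ c Q x y → c ℤ.+ Q ℤ.* (x ℤ.+ y) ≡ (c ℤ.+ Q ℤ.* x) ℤ.+ Q ℤ.* y
    eq = ℤR.solve-∀
    lift : ∀ {n} c → Many n (Descend c P ⊕ P) → Many n ((P ∩ c) ⊕ Scaled P)
    lift c = many-map (λ z → c ℤ.+ Q ℤ.* z) (λ _ _ → affine-injective c)
      (λ where (x , y , p , r , refl) → _ , _ , (p , quot x refl) , (y , r , refl) , eq c Q x y)

  -- With q = 3^m, these are the exponents of a in RT and in TR for R = a^A and T = b^m a^B.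
  Cross : (ℤ → Set) → (ℤ → Set) → ℤ → Set
  Cross A B z = (Scaled A ⊕ B) z ⊎ (A ⊕ B) z

  -- For `B` in one class, q A + B stays in that class, while elements of `A` not divisible by q
  -- move `B` out of it.
  many-cross-split : ∀ {k r u c A B} → Many (suc k) A → Many (suc r) (λ x → A x × x ≉ + 0) → Many (suc u) (B ∩ c) →
    Many (suc (k ℕ.+ u) ℕ.+ suc (r ℕ.+ u)) (Cross A B)
  many-cross-split {c = c} {B = B} mA mR mB =
    many-apart (many-⊕ (many-scaled mA) mB) (many-⊕ mR mB)
      (apartˡ (λ where (x , _ , refl) (_ , y≉0) x≈y → y≉0 (≈-trans (≈-sym x≈y) (quot x (sym (ℤₚ.+-identityˡ _)))))
        (∩-congruent {B} {B} {c}))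
      (inj₁ ∘ ⊕-⊆ id proj₁) (inj₂ ∘ ⊕-⊆ proj₁ proj₁)

  -- Induction on a bound for absolute values, not for the diameter: a translation of `A` shifts q A
  -- + B and A + B by different amounts, so `A` can descend only at 0.
  many-cross : ∀ N k l {A B} → (∀ {x} → A x → ∣ x ∣ ≤ N) → Many (suc k) A → Many (suc l) B →
    ∃[ n₁ ] ∃[ n₂ ] (7 ℕ.* suc k ≤ 2 ℕ.* (n₁ ℕ.+ n₂) ℕ.+ 4 × Many n₁ (A ⊕ A) × Many n₂ (Cross A B))
  many-cross zero k l {A} bd mA mB with many-choose mA | many-choose mB
  ... | x , a | y , b = 1 , 1 , ≤-by 1 (scale 7 (many-single single mA)) (ℕR.solve (k ∷ [])) ,
    many-1 _ (x , x , a , a , refl) , many-1 _ (inj₂ (x , y , a , b , refl))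
    where
    single : ∀ {x y} → A x → A y → x ≡ y
    single a a′ = trans (vanish a) (sym (vanish a′))
      where
      vanish : ∀ {x} → A x → x ≡ + 0
      vanish a = ℤₚ.∣i∣≡0⇒i≡0 (ℕₚ.n≤0⇒n≡0 (bd a))
  many-cross (suc N) k l {A} {B} bd mA mB with many-pivot _≈?_ (λ _ → ≈-refl) mB
  ... | c , u , suc v , refl , m₁ , m₂ = _ , _ , cross-count₁ k u v , many-⊕ mA mA ,
    many-apart (many-⊕ (many-scaled mA) m₁) (many-⊕ (many-scaled mA) m₂)
      (apartʳ (scaled-congruent {A} {A}) (λ (_ , x≈c) (_ , y≉c) x≈y → y≉c (≈-trans (≈-sym x≈y) x≈c)))
      (inj₁ ∘ ⊕-⊆ id proj₁) (inj₁ ∘ ⊕-⊆ id proj₁)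
  ... | c , u , zero , _ , m₁ , _ with many-split (_≈? (+ 0)) mA
  ...   | p , zero , e , mP , _ =
    -- All of `A` is divisible by q and `B` lies in the class of `c`: divide `A` by q and let `B`
    -- descend at `c`.
    let (n₁ , n₂ , le , s₁ , s₂) = many-cross N k u
          (λ {z} a → descend-< z (subst (λ y → ∣ y ∣ ≤ suc N) (ℤₚ.+-identityˡ (Q ℤ.* z)) (bd a)))
          (subst (λ n → Many n (Descend (+ 0) A)) (trans (sym (ℕₚ.+-identityʳ p)) (sym e)) (many-descend mP))
          (many-descend m₁) in
    n₁ , n₂ , le ,
    many-map (λ z → + 0 ℤ.+ Q ℤ.* z) (λ _ _ → affine-injective (+ 0))
      (λ where (x , y , a , b , refl) → _ , _ , a , b , eq₁ Q x y) s₁ ,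
    many-map (λ z → c ℤ.+ Q ℤ.* z) (λ _ _ → affine-injective c)
      (λ where
        (inj₁ (_ , y , (x , a , refl) , b , refl)) → inj₁ (_ , _ , (_ , a , refl) , b , eq₂ c Q x y)
        (inj₂ (x , y , a , b , refl)) → inj₂ (_ , _ , a , b , eq₃ c Q x y)) s₂
    where
    eq₁ : ∀ Q x y → + 0 ℤ.+ Q ℤ.* (x ℤ.+ y) ≡ (+ 0 ℤ.+ Q ℤ.* x) ℤ.+ (+ 0 ℤ.+ Q ℤ.* y)
    eq₁ = ℤR.solve-∀
    eq₂ : ∀ c Q x y → c ℤ.+ Q ℤ.* (Q ℤ.* x ℤ.+ y) ≡ Q ℤ.* (+ 0 ℤ.+ Q ℤ.* x) ℤ.+ (c ℤ.+ Q ℤ.* y)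
    eq₂ = ℤR.solve-∀
    eq₃ : ∀ c Q x y → c ℤ.+ Q ℤ.* (x ℤ.+ y) ≡ (+ 0 ℤ.+ Q ℤ.* x) ℤ.+ (c ℤ.+ Q ℤ.* y)
    eq₃ = ℤR.solve-∀
  ...   | p , suc r , e , mP , mR with ℕₚ.suc-injective (trans e (ℕₚ.+-suc p r)) | ℕₚ.≤-total p (suc r)
  ...     | refl | inj₁ p≤r = _ , _ , cross-count₂ p r u p≤r , many-⊕ mA mA , many-cross-split mA mR m₁
  ...     | refl | inj₂ r≤p = by-p p mP r≤p mA
    where
    by-p : ∀ p → Many p (λ x → A x × x ≈ + 0) → suc r ≤ p → Many (suc (p ℕ.+ r)) A →
      ∃[ n₁ ] ∃[ n₂ ] (7 ℕ.* suc (p ℕ.+ r) ≤ 2 ℕ.* (n₁ ℕ.+ n₂) ℕ.+ 4 × Many n₁ (A ⊕ A) × Many n₂ (Cross A B))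
    by-p (suc p) mP r≤p mA = _ , _ , cross-count₃ p r u r≤p ,
      -- With P the divisible part of `A` and R the rest, P + P lies in class 0 and P + R avoids it.
      many-apart (many-⊕ mP mP) (many-⊕ mP mR)
        (apartʳ (∩-congruent {A} {A} {+ 0}) (λ (_ , x≈0) (_ , y≉0) x≈y → y≉0 (≈-trans (≈-sym x≈y) x≈0)))
        (⊕-⊆ proj₁ proj₁) (⊕-⊆ proj₁ proj₁) ,
      many-cross-split mA mR m₁

-- Commuting elements of BS⁺(1,3)

3^-half : ∀ m → ∃[ h ] (+ (3 ^ m) ≡ + 1 ℤ.+ (h ℤ.+ h))
3^-half zero = + 0 , refl
3^-half (suc m) with 3^-half m
... | h , e = + 1 ℤ.+ + 3 ℤ.* h , trans (ℤₚ.pos-* 3 (3 ^ m)) (trans (cong (+ 3 ℤ.*_) e) (eq h))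
  where
  eq : ∀ h → + 3 ℤ.* (+ 1 ℤ.+ (h ℤ.+ h)) ≡ + 1 ℤ.+ (+ 1 ℤ.+ + 3 ℤ.* h ℤ.+ (+ 1 ℤ.+ + 3 ℤ.* h))
  eq = ℤR.solve-∀

3^-≥2 : ∀ m → 2 ≤ 3 ^ suc m
3^-≥2 m = ℕₚ.≤-trans (s≤s (s≤s z≤n)) (ℕₚ.*-monoʳ-≤ 3 (ℕₚ.m^n>0 3 m))

·-assoc : ∀ s u v → (s · u) · v ≡ s · (u · v)
·-assoc (m , x) (n , y) (p , z) = cong₂ _,_ (ℕₚ.+-assoc m n p) (begin
  + (3 ^ p) ℤ.* (+ (3 ^ n) ℤ.* x ℤ.+ y) ℤ.+ z             ≡⟨ eq (+ (3 ^ p)) (+ (3 ^ n)) x y z ⟩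
  + (3 ^ n) ℤ.* + (3 ^ p) ℤ.* x ℤ.+ (+ (3 ^ p) ℤ.* y ℤ.+ z)
    ≡⟨ cong (λ q → q ℤ.* x ℤ.+ (+ (3 ^ p) ℤ.* y ℤ.+ z))
          (sym (trans (cong +_ (ℕₚ.^-distribˡ-+-* 3 n p)) (ℤₚ.pos-* (3 ^ n) (3 ^ p)))) ⟩
  + (3 ^ (n ℕ.+ p)) ℤ.* x ℤ.+ (+ (3 ^ p) ℤ.* y ℤ.+ z)     ∎)
  where
  open ≡-Reasoning
  eq : ∀ P N x y z → P ℤ.* (N ℤ.* x ℤ.+ y) ℤ.+ z ≡ N ℤ.* P ℤ.* x ℤ.+ (P ℤ.* y ℤ.+ z)
  eq = ℤR.solve-∀

·-cancelˡ : ∀ s {u v} → s · u ≡ s · v → u ≡ v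
·-cancelˡ (m , x) {n , y} {p , z} e with ℕₚ.+-cancelˡ-≡ m n p (cong proj₁ e)
... | refl = cong (n ,_) (∙-cancelˡ (+ (3 ^ n) ℤ.* x) y z (cong proj₂ e))

instance
  3^-nonZero : ∀ {m} → ℤ.NonZero (+ (3 ^ m))
  3^-nonZero {m} = ℕₚ.m^n≢0 3 m

·-cancelʳ : ∀ s {u v} → u · s ≡ v · s → u ≡ v
·-cancelʳ (m , x) {n , y} {p , z} e with ℕₚ.+-cancelʳ-≡ m n p (cong proj₁ e)
... | refl = cong (n ,_) (ℤₚ.*-cancelˡ-≡ (+ (3 ^ m)) y z {{3^-nonZero {m}}} (∙-cancelʳ x _ _ (cong proj₂ e)))

Commute : BS⁺ → BS⁺ → Set
Commute s u = s · u ≡ u · s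

_commute?_ : ∀ s u → Dec (Commute s u)
s commute? u = (s · u) ≟BS (u · s)

commute-· : ∀ s u v → Commute s u → Commute s v → Commute s (u · v)
commute-· s u v su sv = begin
  s · (u · v)   ≡⟨ ·-assoc s u v ⟨
  (s · u) · v   ≡⟨ cong (_· v) su ⟩
  (u · s) · v   ≡⟨ ·-assoc u s v ⟩
  u · (s · v)   ≡⟨ cong (u ·_) sv ⟩
  u · (v · s)   ≡⟨ ·-assoc u v s ⟨
  (u · v) · s   ∎
  where open ≡-Reasoning

commute-cancelˡ : ∀ s u v → Commute s u → Commute s (u · v) → Commute s v
commute-cancelˡ s u v su suv = ·-cancelˡ u (begin
  u · (s · v)   ≡⟨ ·-assoc u s v ⟨
  (u · s) · v   ≡⟨ cong (_· v) su ⟨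
  (s · u) · v   ≡⟨ ·-assoc s u v ⟩
  s · (u · v)   ≡⟨ suv ⟩
  (u · v) · s   ≡⟨ ·-assoc u v s ⟩
  u · (v · s)   ∎)
  where open ≡-Reasoning

commute-cancelʳ : ∀ s u v → Commute s v → Commute s (u · v) → Commute s u
commute-cancelʳ s u v sv suv = ·-cancelʳ v (begin
  (s · u) · v   ≡⟨ ·-assoc s u v ⟩
  s · (u · v)   ≡⟨ suv ⟩
  (u · v) · s   ≡⟨ ·-assoc u v s ⟩
  u · (v · s)   ≡⟨ cong (u ·_) sv ⟨
  u · (s · v)   ≡⟨ ·-assoc u s v ⟨
  (u · s) · v   ∎)
  where open ≡-Reasoning

-- (m , x) and (n , y) commute iff (3ⁿ - 1) x = (3ᵐ - 1) y.
gap : ℕ → ℤ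
gap m = + (3 ^ m) ℤ.- + 1

commute⇒gap : ∀ s u → Commute s u → gap (proj₁ u) ℤ.* proj₂ s ≡ gap (proj₁ s) ℤ.* proj₂ u
commute⇒gap (m , x) (n , y) e = begin
  gap n ℤ.* x                                      ≡⟨ eq₁ (+ (3 ^ n)) x y ⟩
  + (3 ^ n) ℤ.* x ℤ.+ y ℤ.- (x ℤ.+ y)              ≡⟨ cong (λ z → z ℤ.- (x ℤ.+ y)) (cong proj₂ e) ⟩
  + (3 ^ m) ℤ.* y ℤ.+ x ℤ.- (x ℤ.+ y)              ≡⟨ eq₂ (+ (3 ^ m)) x y ⟩
  gap m ℤ.* y                                      ∎
  where
  open ≡-Reasoning
  eq₁ : ∀ N x y → (N ℤ.- + 1) ℤ.* x ≡ N ℤ.* x ℤ.+ y ℤ.- (x ℤ.+ y)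
  eq₁ = ℤR.solve-∀
  eq₂ : ∀ M x y → M ℤ.* y ℤ.+ x ℤ.- (x ℤ.+ y) ≡ (M ℤ.- + 1) ℤ.* y
  eq₂ = ℤR.solve-∀

gap⇒commute : ∀ s u → gap (proj₁ u) ℤ.* proj₂ s ≡ gap (proj₁ s) ℤ.* proj₂ u → Commute s u
gap⇒commute (m , x) (n , y) e = cong₂ _,_ (ℕₚ.+-comm m n) (begin
  + (3 ^ n) ℤ.* x ℤ.+ y              ≡⟨ eq₁ (+ (3 ^ n)) x y ⟩
  gap n ℤ.* x ℤ.+ (x ℤ.+ y)          ≡⟨ cong (λ z → z ℤ.+ (x ℤ.+ y)) e ⟩
  gap m ℤ.* y ℤ.+ (x ℤ.+ y)          ≡⟨ eq₂ (+ (3 ^ m)) x y ⟩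
  + (3 ^ m) ℤ.* y ℤ.+ x              ∎)
  where
  open ≡-Reasoning
  eq₁ : ∀ N x y → N ℤ.* x ℤ.+ y ≡ (N ℤ.- + 1) ℤ.* x ℤ.+ (x ℤ.+ y)
  eq₁ = ℤR.solve-∀
  eq₂ : ∀ M x y → (M ℤ.- + 1) ℤ.* y ℤ.+ (x ℤ.+ y) ≡ M ℤ.* y ℤ.+ x
  eq₂ = ℤR.solve-∀

gap-nonZero : ∀ {m} → 1 ≤ m → ℤ.NonZero (gap m)
gap-nonZero {suc m} _ = ℤ.≢-nonZero λ e →
  ℕₚ.<⇒≢ (3^-≥2 m) (sym (ℤₚ.+-injective (ℤₚ.i-j≡0⇒i≡j _ _ e)))

-- Let b^m a^x act on the line by t ↦ 3^m t + x. For positive degree there is one fixed point,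
-- -x/(3^m - 1), and commuting with such an element means fixing that point; so its centralizer is
-- abelian.
commute-trans : ∀ {s u} v → 1 ≤ proj₁ v → Commute s v → Commute u v → Commute s u
commute-trans {m , x} {n , y} (l , z) l≥1 sv uv = gap⇒commute (m , x) (n , y)
  (ℤₚ.*-cancelˡ-≡ (gap l) _ _ {{gap-nonZero l≥1}} (begin
  gap l ℤ.* (gap n ℤ.* x)    ≡⟨ eq (gap l) (gap n) x ⟩
  gap n ℤ.* (gap l ℤ.* x)    ≡⟨ cong (gap n ℤ.*_) (commute⇒gap (m , x) (l , z) sv) ⟩
  gap n ℤ.* (gap m ℤ.* z)    ≡⟨ eq (gap n) (gap m) z ⟩
  gap m ℤ.* (gap n ℤ.* z)    ≡⟨ cong (gap m ℤ.*_) (commute⇒gap (n , y) (l , z) uv) ⟨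
  gap m ℤ.* (gap l ℤ.* y)    ≡⟨ eq (gap m) (gap l) y ⟩
  gap l ℤ.* (gap m ℤ.* y)    ∎))
  where
  open ≡-Reasoning
  eq : ∀ a b c → a ℤ.* (b ℤ.* c) ≡ b ℤ.* (a ℤ.* c)
  eq = ℤR.solve-∀

commute-unique : ∀ {s u} v → 1 ≤ proj₁ v → Commute s v → Commute u v → proj₁ s ≡ proj₁ u → s ≡ u
commute-unique {m , x} {_ , y} (l , z) l≥1 sv uv refl = cong (m ,_)
  (ℤₚ.*-cancelˡ-≡ (gap l) x y {{gap-nonZero l≥1}}
    (trans (commute⇒gap (m , x) (l , z) sv) (sym (commute⇒gap (m , y) (l , z) uv))))

commute-base : ∀ {s u} → proj₁ s ≡ 0 → proj₁ u ≡ 0 → Commute s u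
commute-base {_ , x} {_ , y} refl refl = gap⇒commute (0 , x) (0 , y) refl

-- Finite search.

module _ {X : Set} where

  max-or-none : ∀ (f : X → ℕ) {P : X → Set} → (∀ x → Dec (P x)) → ∀ xs →
    (∃[ m ] (m ∈ xs × P m × (∀ {y} → y ∈ xs → P y → f y ≤ f m))) ⊎ (∀ {y} → y ∈ xs → ¬ P y)
  max-or-none f P? [] = inj₂ λ ()
  max-or-none f P? (x ∷ xs) with P? x | max-or-none f P? xs
  ... | no ¬p | inj₂ none = inj₂ λ where (here refl) → ¬p ; (there y∈) → none y∈
  ... | no ¬p | inj₁ (m , m∈ , pm , max) = inj₁ (m , there m∈ , pm ,
        λ where (here refl) p → ⊥-elim (¬p p) ; (there y∈) p → max y∈ p)
  ... | yes p | inj₂ none = inj₁ (x , here refl , p ,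
        λ where (here refl) _ → ℕₚ.≤-refl ; (there y∈) q → ⊥-elim (none y∈ q))
  ... | yes p | inj₁ (m , m∈ , pm , max) with ℕₚ.≤-total (f x) (f m)
  ...   | inj₁ x≤m = inj₁ (m , there m∈ , pm , λ where (here refl) _ → x≤m ; (there y∈) q → max y∈ q)
  ...   | inj₂ m≤x = inj₁ (x , here refl , p ,
          λ where (here refl) _ → ℕₚ.≤-refl ; (there y∈) q → ℕₚ.≤-trans (max y∈ q) m≤x)

  search : ∀ {P : X → Set} → (∀ x → Dec (P x)) → ∀ xs → Dec (∃[ x ] (x ∈ xs × P x))
  search P? xs = map′ find (λ (_ , x∈ , p) → lose x∈ p) (any? P? xs)

  many-3 : ∀ {P : X → Set} {x y z} → P x → P y → P z → x ≢ y → x ≢ z → y ≢ z → Many 3 P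
  many-3 {x = x} {y} {z} p q r x≢y x≢z y≢z = x ∷ y ∷ z ∷ [] ,
    (x≢y All.∷ x≢z All.∷ All.[]) AllPairs.∷ (y≢z All.∷ All.[]) AllPairs.∷ All.[] AllPairs.∷ AllPairs.[] ,
    p All.∷ q All.∷ r All.∷ All.[] , refl

abelian-or-not : ∀ S → NonAbelian S ⊎ (∀ {s u} → s ∈ S → u ∈ S → Commute s u)
abelian-or-not S with search (λ s → search (λ u → ¬? (s commute? u)) S) S
... | yes (s , s∈ , u , u∈ , ne) = inj₁ (s , u , s∈ , u∈ , ne)
... | no none = inj₂ λ {s} {u} s∈ u∈ → decidable-stable (s commute? u) λ ne → none (s , s∈ , u , u∈ , ne)

-- Counting products

Sq : List BS⁺ → BS⁺ → Set
Sq S z = ∃[ s ] ∃[ u ] (s ∈ S × u ∈ S × z ≡ s · u)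

Sides : BS⁺ → List BS⁺ → BS⁺ → Set
Sides s S z = ∃[ t ] (t ∈ S × (z ≡ s · t ⊎ z ≡ t · s))

module _ {S : List BS⁺} {s : BS⁺} (below : ∀ {t} → t ∈ S → proj₁ t < proj₁ s) where

  -- With w of maximal degree among the elements of S not commuting with s: `above` treats w of less than maximal
  -- degree in S, `twin` a second element w′ in the coset of w, and `next` an element v just below the lone top w.
  sides-nonabelian : NonAbelian S → Many 3 (λ z → Sides s S z × ¬ Sq S z)
  sides-nonabelian (p , r , p∈ , r∈ , pr) = main
    where
    Goal = Many 3 (λ z → Sides s S z × ¬ Sq S z)

    s≥1 : 1 ≤ proj₁ s
    s≥1 = ℕₚ.≤-trans (s≤s z≤n) (below p∈)

    too-high : ∀ {z} a b {c} → proj₁ z ≡ proj₁ s ℕ.+ c → z ≡ a · b → a ∈ S → proj₁ b ≤ c → ⊥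
    too-high a b {c} e refl a∈ b≤c = ℕₚ.<⇒≢ (ℕₚ.+-mono-<-≤ (below a∈) b≤c) e

    too-high′ : ∀ {z} a b {c} → proj₁ z ≡ proj₁ s ℕ.+ c → z ≡ a · b → b ∈ S → proj₁ a ≤ c → ⊥
    too-high′ a b {c} e refl b∈ a≤c =
      ℕₚ.<⇒≢ (ℕₚ.+-mono-<-≤ (below b∈) a≤c) (trans (ℕₚ.+-comm (proj₁ b) (proj₁ a)) e)

    left : ∀ {t} → t ∈ S → Sides s S (s · t)
    left t∈ = _ , t∈ , inj₁ refl
    right : ∀ {t} → t ∈ S → Sides s S (t · s)
    right t∈ = _ , t∈ , inj₂ refl

    flip-fst : ∀ t → proj₁ (t · s) ≡ proj₁ s ℕ.+ proj₁ t
    flip-fst t = ℕₚ.+-comm (proj₁ t) (proj₁ s)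

    lower : ∀ {a b c d} → c ≢ d → proj₁ a ≡ proj₁ s ℕ.+ c → proj₁ b ≡ proj₁ s ℕ.+ d → a ≢ b
    lower c≢d e e′ refl = c≢d (ℕₚ.+-cancelˡ-≡ (proj₁ s) _ _ (trans (sym e) e′))

    above : ∀ {w u} → w ∈ S → ¬ Commute s w → (∀ {y} → y ∈ S → ¬ Commute s y → proj₁ y ≤ proj₁ w) →
      u ∈ S → (∀ {y} → y ∈ S → proj₁ y ≤ proj₁ u) → proj₁ w < proj₁ u → Goal
    above {w} {u} w∈ sw w-max u∈ u-max w<u = many-3
      (left u∈ , λ (a , b , a∈ , b∈ , e) → too-high a b refl e a∈ (u-max b∈))
      (left w∈ , λ m → sw (commute-cancelˡ s s w refl (central {s · w} refl m)))
      (right w∈ , λ m → sw (commute-cancelʳ s w s refl (central {w · s} (flip-fst w) m)))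
      (lower (ℕₚ.<⇒≢ w<u ∘ sym) refl refl)
      (lower (ℕₚ.<⇒≢ w<u ∘ sym) refl (flip-fst w))
      sw
      where
      -- Factors from `S` have degree below that of `s`, so in a product of this degree both factors
      -- lie above `w` and commute with `s`.
      central : ∀ {z} → proj₁ z ≡ proj₁ s ℕ.+ proj₁ w → Sq S z → Commute s z
      central e (a , b , a∈ , b∈ , refl) = commute-· s a b
        (decidable-stable (s commute? a) λ ne → too-high′ a b e refl b∈ (w-max a∈ ne))
        (decidable-stable (s commute? b) λ ne → too-high a b e refl a∈ (w-max b∈ ne))

    new : ∀ w {z : BS⁺} → (∀ {y} → y ∈ S → proj₁ y ≤ proj₁ w) → proj₁ z ≡ proj₁ s ℕ.+ proj₁ w → Sides s S z →
      Sides s S z × ¬ Sq S z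
    new w w-max e side = side , λ (a , b , a∈ , b∈ , f) → too-high a b e f a∈ (w-max b∈)

    twin : ∀ {w w′} → w ∈ S → ¬ Commute s w → (∀ {y} → y ∈ S → proj₁ y ≤ proj₁ w) →
      w′ ∈ S → proj₁ w′ ≡ proj₁ w → w′ ≢ w → Goal
    twin {w} {w′} w∈ sw w-max w′∈ e w′≢w with (s · w′) ≟BS (w · s)
    ... | no ne = many-3 (new w w-max refl (left w∈)) (new w w-max (flip-fst w) (right w∈))
            (new w w-max (cong (proj₁ s ℕ.+_) e) (left w′∈))
            sw (w′≢w ∘ ·-cancelˡ s ∘ sym) (ne ∘ sym)
    ... | yes sw′≡ws = many-3 (new w w-max refl (left w∈)) (new w w-max (flip-fst w) (right w∈))
            (new w w-max (trans (flip-fst w′) (cong (proj₁ s ℕ.+_) e)) (right w′∈))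
            sw both (w′≢w ∘ ·-cancelʳ s ∘ sym)
      where
      -- Both coincidences together would make `w` commute with s², and `s` lies in the same abelian
      -- centralizer.
      both : s · w ≢ w′ · s
      both sw≡w′s = sw (commute-trans (s · s) (ℕₚ.≤-trans s≥1 (ℕₚ.m≤m+n _ _)) (commute-· s s s refl refl) (begin
        w · (s · s)     ≡⟨ ·-assoc w s s ⟨
        (w · s) · s     ≡⟨ cong (_· s) sw′≡ws ⟨
        (s · w′) · s    ≡⟨ ·-assoc s w′ s ⟩
        s · (w′ · s)    ≡⟨ cong (s ·_) sw≡w′s ⟨
        s · (s · w)     ≡⟨ ·-assoc s s w ⟨
        (s · s) · w     ∎))
        where open ≡-Reasoning

    next : ∀ {w v} → w ∈ S → ¬ Commute s w → (∀ {y} → y ∈ S → proj₁ y ≤ proj₁ w) →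
      v ∈ S → (∀ {y} → y ∈ S → y ≢ w → proj₁ y ≤ proj₁ v) → proj₁ v < proj₁ w → Goal
    next {w} {v} w∈ sw w-max v∈ v-max v<w = extra
      where
      -- If one factor is not `w`, its degree is at most that of `v` and the product falls short of
      -- this degree.
      square : ∀ {z} → proj₁ z ≡ proj₁ s ℕ.+ proj₁ v → Sq S z → z ≡ w · w
      square e (a , b , a∈ , b∈ , f) with a ≟BS w | b ≟BS w
      ... | yes refl | yes refl = f
      ... | no a≢w | _ = ⊥-elim (too-high′ a b e f b∈ (v-max a∈ a≢w))
      ... | _ | no b≢w = ⊥-elim (too-high a b e f a∈ (v-max b∈ b≢w))
      with-v : ∀ {z} → proj₁ z ≡ proj₁ s ℕ.+ proj₁ v → Sides s S z → z ≢ w · w → Goal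
      with-v e side ne = many-3 (side , ne ∘ square e) (new w w-max refl (left w∈))
        (new w w-max (flip-fst w) (right w∈))
        (lower (ℕₚ.<⇒≢ v<w) e refl) (lower (ℕₚ.<⇒≢ v<w) e (flip-fst w)) sw
      extra : Goal
      extra with (s · v) ≟BS (w · w)
      ... | no ne = with-v refl (left v∈) ne
      -- If s v and v s both equal w², then `s` commutes with w², whose centralizer contains `w` and
      -- is abelian.
      ... | yes sv≡ww = with-v (flip-fst v) (right v∈) λ vs≡ww →
            sw (commute-trans (w · w) (ℕₚ.≤-trans (ℕₚ.≤-trans (s≤s z≤n) v<w) (ℕₚ.m≤m+n _ _))
              (subst (Commute s) sv≡ww (commute-· s s v refl (trans sv≡ww (sym vs≡ww))))
              (commute-· w w w refl refl))

    top : ∀ {w} → w ∈ S → ¬ Commute s w → (∀ {y} → y ∈ S → proj₁ y ≤ proj₁ w) → Goal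
    top {w} w∈ sw w-max with search (λ t → (proj₁ t ℕ.≟ proj₁ w) ×-dec ¬? (t ≟BS w)) S
    ... | yes (w′ , w′∈ , e , w′≢w) = twin w∈ sw w-max w′∈ e w′≢w
    ... | no none with max-or-none proj₁ (λ t → ¬? (t ≟BS w)) S
    ...   | inj₁ (v , v∈ , v≢w , v-max) = next w∈ sw w-max v∈ v-max
              (ℕₚ.≤∧≢⇒< (w-max v∈) λ e → none (v , v∈ , e , v≢w))
    ...   | inj₂ only = ⊥-elim (pr (trans (cong₂ _·_ (is-w p∈) (is-w r∈)) (sym (cong₂ _·_ (is-w r∈) (is-w p∈)))))
      where
      is-w : ∀ {t} → t ∈ S → t ≡ w
      is-w {t} t∈ = decidable-stable (t ≟BS w) (only t∈)

    main : Goal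
    main with max-or-none proj₁ (λ t → ¬? (s commute? t)) S | max-or-none proj₁ (λ _ → yes tt) S
    ... | inj₂ none | _ = ⊥-elim (pr (commute-trans s s≥1 (comm p∈) (comm r∈)))
      where
      comm : ∀ {t} → t ∈ S → Commute t s
      comm {t} t∈ = sym (decidable-stable (s commute? t) (none t∈))
    ... | inj₁ _ | inj₂ none = ⊥-elim (none p∈ tt)
    ... | inj₁ (w , w∈ , sw , w-max) | inj₁ (u , u∈ , _ , u-max) with proj₁ w ℕ.<? proj₁ u
    ...   | yes w<u = above w∈ sw w-max u∈ (λ y∈ → u-max y∈ tt) w<u
    ...   | no w≮u = top w∈ sw λ y∈ → ℕₚ.≤-trans (u-max y∈ tt) (ℕₚ.≮⇒≥ w≮u)

  -- The degrees determine the elements of S, so |S²| ≥ 2|S| - 1 by projecting to ℕ.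
  sides-abelian : Unique S → (∀ {p r} → p ∈ S → r ∈ S → Commute p r) →
    ∀ {u} → u ∈ S → 1 ≤ proj₁ u → ¬ Commute s u →
    ∃[ n ] (7 ℕ.* length S ≤ 2 ℕ.* n ℕ.+ 6 × Many n (λ z → Sq S z ⊎ Sides s S z))
  sides-abelian uniq abel {u} u∈ u≥1 su = count S-many
    where
    S-many : Many (length S) (_∈ S)
    S-many = list-many uniq

    unique-fst : ∀ {p r} → p ∈ S → r ∈ S → proj₁ p ≡ proj₁ r → p ≡ r
    unique-fst p∈ r∈ = commute-unique u u≥1 (abel p∈ u∈) (abel r∈ u∈)

    Fst : ℤ → Set
    Fst z = ∃[ p ] (p ∈ S × z ≡ + proj₁ p)

    square : ∀ {t} → Many (suc t) (_∈ S) → Many (suc (t ℕ.+ t)) (Sq S)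
    square m = many-lift (+_ ∘ proj₁)
      (λ where (_ , _ , (p , p∈ , refl) , (r , r∈ , refl) , refl) → p · r , (p , r , p∈ , r∈ , refl) , refl)
      (many-⊕ firsts firsts)
      where
      firsts : Many _ Fst
      firsts = many-map (+_ ∘ proj₁) (λ p∈ r∈ e → unique-fst p∈ r∈ (ℤₚ.+-injective e)) (λ p∈ → _ , p∈ , refl) m

    -- A degree 0 element commuting with `u` is the identity, for which the two side products
    -- coincide; at most one element of `S` is lost here.
    Nontrivial : BS⁺ → Set
    Nontrivial t = t ∈ S × 1 ≤ proj₁ t

    not-commute : ∀ {t} → Nontrivial t → ¬ Commute s t
    not-commute {t} (t∈ , t≥1) st = su (commute-trans t t≥1 st (abel u∈ t∈))

    central : ∀ {z} → Sq S z → Commute u z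
    central (p , r , p∈ , r∈ , refl) = commute-· u p r (abel u∈ p∈) (abel u∈ r∈)

    sides : ∀ {r} → Many r Nontrivial → Many (r ℕ.+ r) (λ z → Sides s S z × ¬ Sq S z)
    sides m = many-∪ (many-map {Q = Left} (s ·_) (λ _ _ → ·-cancelˡ s) (λ t → _ , t , refl) m)
      (many-map {Q = Right} (_· s) (λ _ _ → ·-cancelʳ s) (λ t → _ , t , refl) m)
      (λ where
        (t , t∈ , refl) (t′ , t′∈ , e) → not-commute t∈
          (trans e (cong (_· s) (sym (unique-fst (proj₁ t∈) (proj₁ t′∈)
            (ℕₚ.+-cancelˡ-≡ (proj₁ s) _ _ (trans (cong proj₁ e) (ℕₚ.+-comm (proj₁ t′) (proj₁ s)))))))))
      (λ where (t , (t∈ , _) , refl) → (t , t∈ , inj₁ refl) ,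
                  λ m → su (sym (commute-cancelʳ u s t (abel u∈ t∈) (central m))))
      (λ where (t , (t∈ , _) , refl) → (t , t∈ , inj₂ refl) ,
                  λ m → su (sym (commute-cancelˡ u t s (abel u∈ t∈) (central m))))
      where
      Left Right : BS⁺ → Set
      Left z = ∃[ t ] (Nontrivial t × z ≡ s · t)
      Right z = ∃[ t ] (Nontrivial t × z ≡ t · s)

    count : ∀ {t} → Many t (_∈ S) → ∃[ n ] (7 ℕ.* t ≤ 2 ℕ.* n ℕ.+ 6 × Many n (λ z → Sq S z ⊎ Sides s S z))
    count {zero} m = 0 , z≤n , many-0
    count {suc t} m with many-split (λ t → 1 ℕ.≤? proj₁ t) m
    ... | r , b , e , m₁ , m₂ = _ , bound e (many-single trivial m₂) ,
      many-∪ (square m) (sides m₁) (λ x (_ , ¬x) → ¬x x) inj₁ (inj₂ ∘ proj₁)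
      where
      trivial : ∀ {x y} → x ∈ S × ¬ 1 ≤ proj₁ x → y ∈ S × ¬ 1 ≤ proj₁ y → x ≡ y
      trivial (x∈ , x≱1) (y∈ , y≱1) = unique-fst x∈ y∈
        (trans (ℕₚ.n<1⇒n≡0 (ℕₚ.≰⇒> x≱1)) (sym (ℕₚ.n<1⇒n≡0 (ℕₚ.≰⇒> y≱1))))
      bound : ∀ {t r b} → suc t ≡ r ℕ.+ b → b ≤ 1 → 7 ℕ.* suc t ≤ 2 ℕ.* (suc (t ℕ.+ t) ℕ.+ (r ℕ.+ r)) ℕ.+ 6
      bound {t} {r} {b} e b≤1 = ≤-by (r ℕ.+ 1) (scale 3 t<) (ℕR.solve (t ∷ r ∷ []))
        where
        t< : suc t ≤ r ℕ.+ 1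
        t< = subst (_≤ r ℕ.+ 1) (sym e) (ℕₚ.+-monoʳ-≤ r b≤1)

-- Cosets of ⟨a⟩ and induction on the degree.

Sq-⊆ : ∀ {S T} → (∀ {s} → s ∈ S → s ∈ T) → ∀ {z} → Sq S z → Sq T z
Sq-⊆ f (s , u , s∈ , u∈ , e) = s , u , f s∈ , f u∈ , e

length-filter-¬ : ∀ {X : Set} {P : X → Set} (P? : ∀ x → Dec (P x)) xs →
  length xs ≡ length (filter P? xs) ℕ.+ length (filter (¬? ∘ P?) xs)
length-filter-¬ P? [] = refl
length-filter-¬ P? (x ∷ xs) with P? x
... | yes _ = cong suc (length-filter-¬ P? xs)
... | no _ = trans (cong suc (length-filter-¬ P? xs)) (sym (ℕₚ.+-suc _ _))

bounded : ∀ {X : Set} (f : X → ℕ) xs → ∃[ N ] (∀ {x} → x ∈ xs → f x ≤ N)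
bounded f xs with max-or-none f (λ _ → yes tt) xs
... | inj₁ (m , _ , _ , max) = f m , λ x∈ → max x∈ tt
... | inj₂ none = 0 , λ x∈ → ⊥-elim (none x∈ tt)

Coset : List BS⁺ → ℕ → ℤ → Set
Coset S m x = (m , x) ∈ S

many-coset : ∀ {S n m} {P : BS⁺ → Set} → (∀ {s} → P s → s ∈ S × proj₁ s ≡ m) → Many n P → Many n (Coset S m)
many-coset {m = m} f = many-lift (m ,_) (λ p → let (s∈ , e) = f p in
  _ , subst (λ m → (m , _) ∈ _) e s∈ , cong (_, _) (sym e))

module _ (m : ℕ) where
  private
    h = proj₁ (3^-half (suc m))
    odd = proj₂ (3^-half (suc m))
  open Mod (3 ^ suc m) (3^-≥2 m) h odd

  dilate-coset : ∀ {S k} → Many (suc k) (Coset S (suc m)) →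
    ∃[ n ] (7 ℕ.* suc k ≤ 2 ℕ.* n ℕ.+ 6 × Many n (λ z → Sq S z × proj₁ z ≡ suc m ℕ.+ suc m))
  dilate-coset {S} {k} many =
    let (N , bd) = bounded (∣_∣ ∘ proj₂) S
        (n , le , d) = many-dilate (N ℕ.+ N) k
          (λ {x} {y} p r → ℕₚ.≤-trans (ℤₚ.∣i-j∣≤∣i∣+∣j∣ x y) (ℕₚ.+-mono-≤ (bd p) (bd r))) many in
    n , le , many-map (suc m ℕ.+ suc m ,_) (λ _ _ → cong proj₂)
      (λ where (x , _ , p , (y , r , refl) , refl) →
                 ((_ , y) , (_ , x) , r , p , cong (_ ,_) (ℤₚ.+-comm x (Q ℤ.* y))) , refl) d

  -- Here S² has degree 0 and the side products have degree `suc m`, so both counts of `many-cross`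
  -- add up.
  sides-base : ∀ {S T l} → Unique S → (∀ {t} → t ∈ S → proj₁ t ≡ 0) → Many (suc l) (Coset T (suc m)) →
    ∃[ n ] (7 ℕ.* length S ≤ 2 ℕ.* n ℕ.+ 6 × Many n (λ z → Sq S z ⊎ ∃[ s ] (s ∈ T × Sides s S z)))
  sides-base {S} {T} {l} uniq zero-fst top = count (many-coset (λ s∈ → s∈ , zero-fst s∈) (list-many uniq))
    where
    product : ∀ {x y} → (0 , x) ∈ S → (0 , y) ∈ S → Sq S (0 , x ℤ.+ y)
    product {x} {y} x∈ y∈ = _ , _ , x∈ , y∈ , cong (λ z → (0 , z ℤ.+ y)) (sym (ℤₚ.*-identityˡ x))

    side : ∀ {z} → Cross (Coset S 0) (Coset T (suc m)) z → ∃[ s ] (s ∈ T × Sides s S (suc m , z))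
    side (inj₁ (_ , y , (x , x∈ , refl) , y∈ , refl)) = (_ , y) , y∈ , (_ , x) , x∈ , inj₂ refl
    side (inj₂ (x , y , x∈ , y∈ , refl)) = (_ , y) , y∈ , (_ , x) , x∈ ,
      inj₁ (cong₂ _,_ (sym (ℕₚ.+-identityʳ (suc m)))
        (trans (ℤₚ.+-comm x y) (cong (ℤ._+ x) (sym (ℤₚ.*-identityˡ y)))))

    count : ∀ {t} → Many t (Coset S 0) →
      ∃[ n ] (7 ℕ.* t ≤ 2 ℕ.* n ℕ.+ 6 × Many n (λ z → Sq S z ⊎ ∃[ s ] (s ∈ T × Sides s S z)))
    count {zero} _ = 0 , z≤n , many-0
    count {suc k} base =
      let (N , bd) = bounded (∣_∣ ∘ proj₂) S
          (n₁ , n₂ , le , s₁ , s₂) = many-cross N k l bd base top in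
      n₁ ℕ.+ n₂ , ℕₚ.≤-trans le (ℕₚ.+-monoʳ-≤ (2 ℕ.* (n₁ ℕ.+ n₂)) (s≤s (s≤s (s≤s (s≤s z≤n))))) ,
      many-∪
        (many-map {Q = λ z → Sq S z × proj₁ z ≡ 0} (0 ,_) (λ _ _ → cong proj₂)
          (λ where (x , y , x∈ , y∈ , refl) → product x∈ y∈ , refl) s₁)
        (many-map {Q = λ z → (∃[ s ] (s ∈ T × Sides s S z)) × proj₁ z ≡ suc m} (suc m ,_) (λ _ _ → cong proj₂)
          (λ c → side c , refl) s₂)
        (λ (_ , e) (_ , e′) → ℕₚ.0≢1+n (trans (sym e) e′)) (inj₁ ∘ proj₁) (inj₂ ∘ proj₁)

-- The constant 12 is shared out as 6 for the square of the top coset and 6 for all other products.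
SquareBound : List BS⁺ → Set
SquareBound S = ∃[ n ] (7 ℕ.* length S ≤ 2 ℕ.* n ℕ.+ 12 × Many n (Sq S))

-- For non-abelian `S` the three new side products improve the inductive constant from 12 to 6. An
-- abelian `S` needs some element of `T` that does not commute with a given element of positive
-- degree, unless `S` lies in ⟨a⟩.
many-sides : ∀ {S T l m} → Unique S → (∀ {t} → t ∈ S → proj₁ t < suc m) → Many (suc l) (Coset T (suc m)) →
  (∀ {t} → t ∈ T → proj₁ t ≡ suc m) →
  (NonAbelian S → SquareBound S) →
  ((∀ {p r} → p ∈ S → r ∈ S → Commute p r) → ∀ {u} → u ∈ S → 1 ≤ proj₁ u → ∃[ s ] (s ∈ T × ¬ Commute s u)) →
  ∃[ n ] (7 ℕ.* length S ≤ 2 ℕ.* n ℕ.+ 6 × Many n (λ z → Sq S z ⊎ ∃[ s ] (s ∈ T × Sides s S z)))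
many-sides {S} {T} {l} {m} uniq below top T-fst ih partner with abelian-or-not S
... | inj₁ nonab =
  let (n , le , sq) = ih nonab
      (x , s∈) = many-choose top in
  n ℕ.+ 3 , ≤-by 0 le (count n (length S)) ,
  many-∪ sq (sides-nonabelian {s = suc m , x} below nonab) (λ z (_ , ¬z) → ¬z z) inj₁
    (λ (side , _) → inj₂ (_ , s∈ , side))
  where
  count : ∀ n k → 7 ℕ.* k ℕ.+ (2 ℕ.* n ℕ.+ 12) ℕ.+ 0 ≡ 2 ℕ.* (n ℕ.+ 3) ℕ.+ 6 ℕ.+ 7 ℕ.* k
  count = ℕR.solve-∀
... | inj₂ abel with search (λ t → 1 ℕ.≤? proj₁ t) S
...   | no none = sides-base m uniq (λ t∈ → ℕₚ.n<1⇒n≡0 (ℕₚ.≰⇒> λ t≥1 → none (_ , t∈ , t≥1))) top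
...   | yes (u , u∈ , u≥1) with partner abel u∈ u≥1
...     | s , s∈ , su =
  let (n , le , many) = sides-abelian {s = s} (λ t∈ → subst (_ <_) (sym (T-fst s∈)) (below t∈)) uniq abel u∈ u≥1 su in
  n , le , many-⊆ (λ where (inj₁ z) → inj₁ z ; (inj₂ z) → inj₂ (s , s∈ , z)) many

-- Induction on a bound for the degrees. If the top coset is nonempty, its square has degree exactly
-- twice `suc m` and every other product has smaller degree, so the two bounds add up.
square-bound : ∀ N S → Unique S → (∀ {s} → s ∈ S → proj₁ s ≤ N) → NonAbelian S → SquareBound S
square-bound zero S uniq bd (s , u , s∈ , u∈ , su) =
  ⊥-elim (su (commute-base (ℕₚ.n≤0⇒n≡0 (bd s∈)) (ℕₚ.n≤0⇒n≡0 (bd u∈))))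
square-bound (suc m) S uniq bd nonab = go (length T) refl
  where
  T? : ∀ s → Dec (proj₁ s ≡ suc m)
  T? s = proj₁ s ℕ.≟ suc m
  T R : List BS⁺
  T = filter T? S
  R = filter (¬? ∘ T?) S

  R-below : ∀ {t} → t ∈ R → proj₁ t < suc m
  R-below t∈ = let (t∈S , ne) = ∈-filter⁻ (¬? ∘ T?) t∈ in ℕₚ.≤∧≢⇒< (bd t∈S) ne

  partner : (∀ {p r} → p ∈ R → r ∈ R → Commute p r) → ∀ {u} → u ∈ R → 1 ≤ proj₁ u → ∃[ s ] (s ∈ T × ¬ Commute s u)
  partner abel {u} u∈ u≥1 with search (λ s → ¬? (s commute? u)) T
  ... | yes found = found
  -- If all of `T` commuted with `u`, so would all of `S`, and `S` would be abelian.
  ... | no none = let (p , r , p∈ , r∈ , pr) = nonab in ⊥-elim (pr (commute-trans u u≥1 (central p∈) (central r∈)))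
    where
    central : ∀ {t} → t ∈ S → Commute t u
    central {t} t∈ with T? t
    ... | yes e = decidable-stable (t commute? u) λ ne → none (t , ∈-filter⁺ T? t∈ e , ne)
    ... | no ne = abel (∈-filter⁺ (¬? ∘ T?) t∈ ne) u∈

  go : ∀ l → length T ≡ l → SquareBound S
  go zero e = square-bound m S uniq (λ s∈ → ℕₚ.≤-pred (ℕₚ.≤∧≢⇒< (bd s∈) (not-top s∈))) nonab
    where
    not-top : ∀ {s} → s ∈ S → proj₁ s ≢ suc m
    not-top s∈ e′ = empty e (∈-filter⁺ T? s∈ e′)
      where
      empty : ∀ {s} {xs : List BS⁺} → length xs ≡ 0 → ¬ s ∈ xs
      empty {xs = []} _ ()
  go (suc l) e =
    let top = many-coset {S = T} (λ s∈ → s∈ , T-fst s∈)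
                (subst (λ k → Many k (_∈ T)) e (list-many (Unique.filter⁺ T? uniq)))
        (n₁ , le₁ , high) = dilate-coset m top
        (n₂ , le₂ , low) = many-sides (Unique.filter⁺ (¬? ∘ T?) uniq) R-below top T-fst
          (square-bound m R (Unique.filter⁺ (¬? ∘ T?) uniq) (ℕₚ.≤-pred ∘ R-below)) partner in
    n₁ ℕ.+ n₂ ,
    subst (λ k → 7 ℕ.* k ≤ 2 ℕ.* (n₁ ℕ.+ n₂) ℕ.+ 12) (sym (trans (length-filter-¬ T? S) (cong (ℕ._+ length R) e)))
      (sum l (length R) n₁ n₂ le₁ le₂) ,
    many-∪ high low (λ (_ , e) z → ℕₚ.<⇒≢ (low-fst z) e) (λ (z , _) → Sq-⊆ T⊆S z) (λ where
      (inj₁ z) → Sq-⊆ R⊆S z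
      (inj₂ (s , s∈ , t , t∈ , inj₁ e)) → s , t , T⊆S s∈ , R⊆S t∈ , e
      (inj₂ (s , s∈ , t , t∈ , inj₂ e)) → t , s , R⊆S t∈ , T⊆S s∈ , e)
    where
    T⊆S : ∀ {s} → s ∈ T → s ∈ S
    T⊆S = proj₁ ∘ ∈-filter⁻ T?
    R⊆S : ∀ {s} → s ∈ R → s ∈ S
    R⊆S = proj₁ ∘ ∈-filter⁻ (¬? ∘ T?)
    T-fst : ∀ {s} → s ∈ T → proj₁ s ≡ suc m
    T-fst = proj₂ ∘ ∈-filter⁻ T? {xs = S}
    low-fst : ∀ {z} → Sq R z ⊎ ∃[ s ] (s ∈ T × Sides s R z) → proj₁ z < suc m ℕ.+ suc m
    low-fst (inj₁ (p , r , p∈ , r∈ , refl)) = ℕₚ.+-mono-< (R-below p∈) (R-below r∈)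
    low-fst (inj₂ (s , s∈ , t , t∈ , inj₁ refl)) = ℕₚ.+-mono-≤-< (ℕₚ.≤-reflexive (T-fst s∈)) (R-below t∈)
    low-fst (inj₂ (s , s∈ , t , t∈ , inj₂ refl)) = ℕₚ.+-mono-<-≤ (R-below t∈) (ℕₚ.≤-reflexive (T-fst s∈))
    sum : ∀ l r n₁ n₂ → 7 ℕ.* suc l ≤ 2 ℕ.* n₁ ℕ.+ 6 → 7 ℕ.* r ≤ 2 ℕ.* n₂ ℕ.+ 6 →
      7 ℕ.* (suc l ℕ.+ r) ≤ 2 ℕ.* (n₁ ℕ.+ n₂) ℕ.+ 12
    sum l r n₁ n₂ p q = ≤-by 0 (ℕₚ.+-mono-≤ p q) (ℕR.solve (l ∷ r ∷ n₁ ∷ n₂ ∷ []))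

-- From counted predicates to `card`.

card-bound : ∀ S → Unique S → NonAbelian S → 7 ℕ.* length S ≤ 2 ℕ.* card (sq S) ℕ.+ 12
card-bound S uniq nonab =
  let (N , bd) = bounded proj₁ S
      (n , le , many) = square-bound N S uniq bd nonab in
  ℕₚ.≤-trans le (ℕₚ.+-monoˡ-≤ 12 (scale 2 (many⇒≤length (deduplicate _≟BS_ (sq S)) (∈-deduplicate⁺ _≟BS_ ∘ ∈-sq) many)))
  where
  ∈-sq : ∀ {z} → Sq S z → z ∈ sq S
  ∈-sq (s , u , s∈ , u∈ , refl) = ∈-concatMap⁺ (λ s → map (s ·_) S) (lose s∈ (∈-map⁺ (s ·_) u∈))

-- Carries the bound from natural numbers to the integers, where the strict inequality of (ii) is
-- stated.
bound-contradiction : ∀ k c → 7 ℕ.* k ≤ 2 ℕ.* c ℕ.+ 12 → ¬ (+ 2) ℤ.* (+ c) ℤ.< (+ 7) ℤ.* (+ k) ℤ.- (+ 12)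
bound-contradiction k c le lt = ℤₚ.<⇒≱ (ℤₚ.+-monoˡ-< (+ 12) lt) (begin
  + 7 ℤ.* + k ℤ.- + 12 ℤ.+ + 12   ≡⟨ eq (+ 7 ℤ.* + k) ⟩
  + 7 ℤ.* + k                     ≡⟨ ℤₚ.pos-* 7 k ⟨
  + (7 ℕ.* k)                     ≤⟨ ℤ.+≤+ le ⟩
  + (2 ℕ.* c ℕ.+ 12)              ≡⟨ cong (ℤ._+ + 12) (ℤₚ.pos-* 2 c) ⟩
  + 2 ℤ.* + c ℤ.+ + 12            ∎)
  where
  open ℤₚ.≤-Reasoning
  eq : ∀ z → z ℤ.- + 12 ℤ.+ + 12 ≡ z
  eq = ℤR.solve-∀

theorem1p2 : (S : List BS⁺) → Unique S → 3 ≤ length S → NonAbelian S →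
  -- (i) S meets at least two cosets b^m⟨a⟩ (t ≥ 1)  ⇒  |S²| ≥ (7/2)|S| - 6
  ((∃[ s ] ∃[ u ] (s ∈ S × u ∈ S × proj₁ s ≢ proj₁ u)) →
     7 ℕ.* length S ℕ.≤ 2 ℕ.* card (sq S) ℕ.+ 12)
  ×
  -- (ii) S = b^r a^A with 0 ∈ A, |A| = k, |S²| = (t+2)k - 2t + h < (7/2)k - 6, t = c₃(A)
  ((r : ℕ) (A : List ℤ) → Unique A → (∀ s → s ∈ S ⇔ (∃[ x ] (x ∈ A × s ≡ (r , x)))) →
     + 0 ∈ A → length A ≡ length S → (h : ℤ) →
     + card (sq S) ≡ (+ (c₃ A ℕ.+ 2)) ℤ.* (+ length S) ℤ.- (+ (2 ℕ.* c₃ A)) ℤ.+ h →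
     (+ 2) ℤ.* (+ card (sq S)) ℤ.< (+ 7) ℤ.* (+ length S) ℤ.- (+ 12) →
     ∃[ n ] (+ n ≡ (+ length S) ℤ.+ h × InAP A n ×
       (+ 2) ℤ.* (+ n) ℤ.< (+ 5) ℤ.* (+ length S) ℤ.- (+ 2) ℤ.* (+ c₃ A) ℤ.* ((+ length S) ℤ.- (+ 2)) ℤ.- (+ 12)))
theorem1p2 S uniq _ nonab =
  (λ _ → card-bound S uniq nonab) ,
  (λ _ _ _ _ _ _ _ _ small → ⊥-elim (bound-contradiction (length S) (card (sq S)) (card-bound S uniq nonab) small))
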